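{- Let $G$ be a group with finite presentation $G=\langle s_1,\dots,s_m\mid r_1,\dots,r_n\rangle$. Then for every vertex $x$ of the graph $X_{\langle S\mid R\rangle}$ one has $A_1(X_{\langle S\mid R\rangle},x)\cong G$.
   Context: Graphs are simple undirected loopless graphs; graph maps send adjacent vertices to equal or adjacent vertices; colimits in $\mathsf{Graph}$: the vertex set of a pushout is the pushout of vertex sets, edges are images of edges whose endpoints remain distinct. $I_n$ has vertices $0,\dots,n$, edges $i\sim i+1$; $C_k$ ($k\ge3$) is the cycle on $\mathbb{Z}/k$ with $i\sim i+1$. The box product $A\square B$ has vertices $V(A)\times V(B)$, $(a,b)\sim(a',b')$ iff ($a\sim a'$, $b=b'$) or ($a=a'$, $b\sim b'$). The cone $\mathsf{Cone}_3(Y)$ is the pushout of $Y\square I_3\leftarrow Y\square I_0\to I_0$ (collapse all $(y,0)$ to one vertex); the disk $D_{k,3}=\mathsf{Cone}_3(C_k)$ with boundary map $\partial_{k,3}\colon C_k\to D_{k,3}$, $i\mapsto(i,3)$. $\bigvee_{i=1}^mC_5$ is the wedge of $m$ copies of $C_5$ glued at the vertex $0$; write $(i,t)$, $t\in\mathbb{Z}/5$, for vertex $t$ of the $i$-th copy. Each relator $r_j$ is a word $s_{i_1}^{d_1}\cdots s_{i_k}^{d_k}$ in the generators; its degree is $\deg(r_j)=|d_1|+\dots+|d_k|$ (assumed $\ge1$). Expanding $r_j$ as a sequence of $N=\deg(r_j)$ letters $s_{a_1}^{\epsilon_1}\cdots s_{a_N}^{\epsilon_N}$ with $\epsilon_l=\pm1$,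 define $\varepsilon_{r_j}\colon C_{5N}\to\bigvee_{i=1}^mC_5$ by $5(l-1)+t\mapsto(a_l,\epsilon_l t\bmod 5)$ for $l=1,\dots,N$, $t=0,\dots,4$ (wrapping once around the $a_l$-th circle, clockwise if $\epsilon_l=1$, counter-clockwise if $\epsilon_l=-1$). The graph $X_{\langle S\mid R\rangle}$ is the pushout of $\coprod_{j=1}^nD_{5\deg(r_j),3}\xleftarrow{\coprod_j\partial_{5\deg(r_j),3}}\coprod_{j=1}^nC_{5\deg(r_j)}\xrightarrow{(\varepsilon_{r_j})_j}\bigvee_{i=1}^mC_5$. $A_1(X,x)$ is the fundamental group: path-homotopy classes of finite loops at $x$ (path-components of the quotient of $\coprod_nP_nX(x,x)$ by reparametrization along surjective order-preserving maps $I_{m'}\to I_n$; $P_nX(x,x)$ has loops $I_n\to X$ as vertices, adjacent iff distinct and pointwise equal-or-adjacent) under concatenation. -}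

module Defs where

open import Data.Nat using (ℕ; zero; suc; _+_; _*_)
open import Data.Nat.Properties using (*-comm)
open import Data.Fin using (Fin; zero; suc; toℕ; fromℕ; cast; remQuot) renaming (_≤_ to _≤F_)
open import Data.Integer using (ℤ; ∣_∣; sign)
open import Data.Sign using (Sign; opposite) renaming (+ to ⊕; - to ⊖)
open import Data.List using (List; []; _∷_; _++_; length; replicate; lookup; map)
open import Data.Nat.ListAction using (sum)
open import Data.List.Properties using (length-++; length-replicate)
open import Data.List.Relation.Binary.Pointwise using (Pointwise)
open import Data.Product using (Σ; _×_; _,_; ∃)
open import Data.Sum using (_⊎_; inj₁; inj₂)
open import Relation.Nullary using (¬_)
open import Relation.Binary using (IsEquivalence)
open import Relation.Binary.PropositionalEquality as PE using (_≡_; refl; cong₂; subst)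
open import Relation.Binary.Construct.Closure.Equivalence as EC using (EqClosure)

-- Graphs whose vertex set is presented as a type modulo an equivalence
-- relation _≈_ (needed since colimits/quotients are not available as
-- types).  _~_ is a *raw* adjacency relation on representatives; the
-- actual (simple, loopless) graph has vertex set V/≈ and [u],[v] are
-- adjacent iff [u] ≠ [v] and some representatives are raw-adjacent
-- (see Adj).  This is exactly how edges of a colimit in Graph arise.

record SGraph : Set₁ where
  field
    V       : Set
    _≈_     : V → V → Set
    _~_     : V → V → Set
    ≈-equiv : IsEquivalence _≈_

open SGraph public using () renaming (V to Vert)

module _ (G : SGraph) where
  open SGraph G

  Adj : V → V → Set
  Adj u v = ¬ (u ≈ v) × Σ V λ u' → Σ V λ v' → (u ≈ u') × (v ≈ v') × (u' ~ v')

  EqOrAdj : V → V → Set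
  EqOrAdj u v = (u ≈ v) ⊎ Adj u v

plain : (A : Set) → (A → A → Set) → SGraph
plain A R = record { V = A ; _≈_ = _≡_ ; _~_ = R ; ≈-equiv = PE.isEquivalence }

Interval : ℕ → SGraph
Interval n = plain (Fin (suc n)) λ i j → (suc (toℕ i) ≡ toℕ j) ⊎ (suc (toℕ j) ≡ toℕ i)

Point : SGraph
Point = Interval 0

-- the cycle C_k on ℤ/k (used for k ≥ 3), edges i ~ i+1 mod k
CSucc : (k : ℕ) → Fin k → Fin k → Set
CSucc k i j = (suc (toℕ i) ≡ toℕ j) ⊎ ((suc (toℕ i) ≡ k) × (toℕ j ≡ 0))

Cycle : ℕ → SGraph
Cycle k = plain (Fin k) λ i j → CSucc k i j ⊎ CSucc k j i

_□_ : SGraph → SGraph → SGraph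
A □ B = record
  { V = Vert A × Vert B
  ; _≈_ = λ { (a , b) (a' , b') → (a ≈A a') × (b ≈B b') }
  ; _~_ = λ { (a , b) (a' , b') → ((a ~A a') × (b ≈B b')) ⊎ ((a ≈A a') × (b ~B b')) }
  ; ≈-equiv = record
      { refl = IsEquivalence.refl eA , IsEquivalence.refl eB
      ; sym = λ { (p , q) → IsEquivalence.sym eA p , IsEquivalence.sym eB q }
      ; trans = λ { (p , q) (p' , q') → IsEquivalence.trans eA p p' , IsEquivalence.trans eB q q' }
      }
  }
  where
  open SGraph A renaming (_≈_ to _≈A_; _~_ to _~A_; ≈-equiv to eA)
  open SGraph B renaming (_≈_ to _≈B_; _~_ to _~B_; ≈-equiv to eB)

data ΣRel {I : Set} (A : I → Set) (R : ∀ i → A i → A i → Set) : Σ I A → Σ I A → Set where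
  inΣ : ∀ {i x y} → R i x y → ΣRel A R (i , x) (i , y)

Coprod : {n : ℕ} → (Fin n → SGraph) → SGraph
Coprod {n} D = record
  { V = Σ (Fin n) (λ j → Vert (D j))
  ; _≈_ = ΣRel (λ j → Vert (D j)) (λ j → SGraph._≈_ (D j))
  ; _~_ = ΣRel (λ j → Vert (D j)) (λ j → SGraph._~_ (D j))
  ; ≈-equiv = record
      { refl = λ { {j , _} → inΣ (IsEquivalence.refl (SGraph.≈-equiv (D j))) }
      ; sym = λ { {j , _} (inΣ p) → inΣ (IsEquivalence.sym (SGraph.≈-equiv (D j)) p) }
      ; trans = λ { {j , _} (inΣ p) (inΣ q) → inΣ (IsEquivalence.trans (SGraph.≈-equiv (D j)) p q) }
      }
  }

-- pushout of  A ←f− C −g→ B  (only the vertex maps of C matter)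
module _ (A B : SGraph) {C : Set} (f : C → Vert A) (g : C → Vert B) where
  open SGraph A renaming (_≈_ to _≈A_; _~_ to _~A_)
  open SGraph B renaming (_≈_ to _≈B_; _~_ to _~B_)

  data PGen : Vert A ⊎ Vert B → Vert A ⊎ Vert B → Set where
    eqA  : ∀ {a a'} → a ≈A a' → PGen (inj₁ a) (inj₁ a')
    eqB  : ∀ {b b'} → b ≈B b' → PGen (inj₂ b) (inj₂ b')
    glue : (c : C) → PGen (inj₁ (f c)) (inj₂ (g c))

  data PAdj : Vert A ⊎ Vert B → Vert A ⊎ Vert B → Set where
    adjA : ∀ {a a'} → a ~A a' → PAdj (inj₁ a) (inj₁ a')
    adjB : ∀ {b b'} → b ~B b' → PAdj (inj₂ b) (inj₂ b')

  Pushout : SGraph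
  Pushout = record
    { V = Vert A ⊎ Vert B
    ; _≈_ = EqClosure PGen
    ; _~_ = PAdj
    ; ≈-equiv = EC.isEquivalence PGen
    }

Cone3 : SGraph → SGraph
Cone3 Y = Pushout (Y □ Interval 3) Point {Vert (Y □ Point)} (λ { (y , _) → (y , zero) }) (λ _ → zero)

Disk : ℕ → SGraph
Disk k = Cone3 (Cycle k)

boundary : (k : ℕ) → Fin k → Vert (Disk k)
boundary k i = inj₁ (i , fromℕ 3)

Wedge : ℕ → SGraph
Wedge m = Pushout Point (Coprod (λ (_ : Fin m) → Cycle 5)) {Fin m} (λ _ → zero) (λ i → (i , zero))

wv : {m : ℕ} → Fin m → Fin 5 → Vert (Wedge m)
wv i t = inj₂ (i , t)

-- a relator s_{i1}^{d1} ⋯ s_{ik}^{dk}, as its list of syllables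
Relator : ℕ → Set
Relator m = List (Fin m × ℤ)

deg : {m : ℕ} → Relator m → ℕ
deg r = sum (map (λ { (_ , d) → ∣ d ∣ }) r)

Word : ℕ → Set
Word m = List (Fin m × Sign)

expand : {m : ℕ} → Relator m → Word m
expand []              = []
expand ((a , d) ∷ r)   = replicate ∣ d ∣ (a , sign d) ++ expand r

length-expand : {m : ℕ} (r : Relator m) → length (expand r) ≡ deg r
length-expand []            = refl
length-expand ((a , d) ∷ r) =
  PE.trans (length-++ (replicate ∣ d ∣ (a , sign d)))
           (cong₂ _+_ (length-replicate ∣ d ∣) (length-expand r))

-- t ↦ ε t mod 5
rot : Sign → Fin 5 → Fin 5
rot ⊕ t = t
rot ⊖ zero = zero
rot ⊖ (suc zero) = suc (suc (suc (suc zero)))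
rot ⊖ (suc (suc zero)) = suc (suc (suc zero))
rot ⊖ (suc (suc (suc zero))) = suc (suc zero)
rot ⊖ (suc (suc (suc (suc zero)))) = suc zero

-- ε_r : C_{5 deg r} → ⋁ C_5,  5l + t ↦ (a_{l+1}, ε_{l+1} t mod 5)   (l from 0)
εmap : {m : ℕ} (r : Relator m) → Fin (5 * deg r) → Vert (Wedge m)
εmap r k with remQuot {deg r} 5 (cast (*-comm 5 (deg r)) k)
... | l , t with lookup (expand r) (cast (PE.sym (length-expand r)) l)
...   | a , s = wv a (rot s t)

X : {m n : ℕ} → (Fin n → Relator m) → SGraph
X {m} {n} R =
  Pushout (Coprod (λ j → Disk (5 * deg (R j)))) (Wedge m)
          {Σ (Fin n) (λ j → Fin (5 * deg (R j)))}
          (λ { (j , i) → (j , boundary (5 * deg (R j)) i) })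
          (λ { (j , i) → εmap (R j) i })

module _ (G : SGraph) where
  open SGraph G
  open IsEquivalence ≈-equiv renaming (refl to ≈-refl)

  -- a map I_n → G given by its list of values v₀, v₁, …, v_n
  data Walk : V → List V → Set where
    []  : ∀ {v} → Walk v []
    _∷_ : ∀ {v w ws} → EqOrAdj G v w → Walk w ws → Walk v (w ∷ ws)

  lastV : V → List V → V
  lastV v []       = v
  lastV v (w ∷ ws) = lastV w ws

  record Loop (x : V) : Set where
    constructor loop
    field
      start  : V
      rest   : List V
      walk   : Walk start rest
      start≈ : start ≈ x
      end≈   : lastV start rest ≈ x

    len : ℕ
    len = length rest

    at : Fin (suc len) → V
    at = lookup (start ∷ rest)

  open Loop

  module _ {x : V} where
    -- generating relation of the path-homotopy equivalence:
    --   * adjacency (or equality) in P_n G(x,x): pointwise equal-or-adjacent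
    --   * reparametrization along a surjective order-preserving ρ : I_{n'} → I_n
    data LoopStep : Loop x → Loop x → Set where
      htpy    : ∀ {γ δ} → Pointwise (EqOrAdj G) (start γ ∷ rest γ) (start δ ∷ rest δ)
              → LoopStep γ δ
      reparam : ∀ {γ δ} (ρ : Fin (suc (len δ)) → Fin (suc (len γ)))
              → (∀ i j → i ≤F j → ρ i ≤F ρ j)
              → (∀ k → ∃ λ i → ρ i ≡ k)
              → (∀ i → at δ i ≡ at γ (ρ i))
              → LoopStep δ γ

    _≃_ : Loop x → Loop x → Set
    _≃_ = EqClosure LoopStep

  EqOrAdj-respˡ : ∀ {u u' v} → u ≈ u' → EqOrAdj G u v → EqOrAdj G u' v
  EqOrAdj-respˡ p (inj₁ e) = inj₁ (trans (sym p) e)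
  EqOrAdj-respˡ p (inj₂ (ne , a , b , ua , vb , ab)) =
    inj₂ ((λ e → ne (trans p e)) , a , b , trans (sym p) ua , vb , ab)

  walk-resp : ∀ {u u' ws} → u ≈ u' → Walk u ws → Walk u' ws
  walk-resp p []      = []
  walk-resp p (s ∷ w) = EqOrAdj-respˡ p s ∷ w

  walk-++ : ∀ {v w vs ws} → Walk v vs → lastV v vs ≈ w → Walk w ws → Walk v (vs ++ ws)
  walk-++ []      p q = walk-resp (sym p) q
  walk-++ (s ∷ r) p q = s ∷ walk-++ r p q

  last-++ : ∀ v vs ws → lastV v (vs ++ ws) ≡ lastV (lastV v vs) ws
  last-++ v []       ws = refl
  last-++ v (w ∷ vs) ws = last-++ w vs ws

  last-resp : ∀ {u u'} ws → u ≈ u' → lastV u ws ≈ lastV u' ws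
  last-resp []       p = p
  last-resp (w ∷ ws) p = ≈-refl

  _·_ : {x : V} → Loop x → Loop x → Loop x
  _·_ {x} γ δ = loop (start γ) (rest γ ++ rest δ)
    (walk-++ (walk γ) (trans (end≈ γ) (sym (start≈ δ))) (walk δ))
    (start≈ γ)
    (subst (λ z → z ≈ x) (PE.sym (last-++ (start γ) (rest γ) (rest δ)))
       (trans (last-resp (rest δ) (trans (end≈ γ) (sym (start≈ δ)))) (end≈ δ)))

-- Setoid magmas and isomorphisms (bijective multiplicative maps
-- respecting the equivalences); for groups this is group isomorphism.

record SetoidMagma : Set₁ where
  field
    Carrier : Set
    _≈_     : Carrier → Carrier → Set
    _∙_     : Carrier → Carrier → Carrier

record _≅_ (M N : SetoidMagma) : Set where
  private
    module M = SetoidMagma M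
    module N = SetoidMagma N
  field
    to      : M.Carrier → N.Carrier
    from    : N.Carrier → M.Carrier
    to-cong   : ∀ {a b} → a M.≈ b → to a N.≈ to b
    from-cong : ∀ {a b} → a N.≈ b → from a M.≈ from b
    to-hom    : ∀ a b → to (a M.∙ b) N.≈ (to a N.∙ to b)
    to-from   : ∀ a → to (from a) N.≈ a
    from-to   : ∀ a → from (to a) M.≈ a

A1 : (G : SGraph) → Vert G → SetoidMagma
A1 G x = record { Carrier = Loop G x ; _≈_ = _≃_ G ; _∙_ = _·_ G }

data WStep {m n : ℕ} (R : Fin n → Relator m) : Word m → Word m → Set where
  cancel  : ∀ u v a s → WStep R (u ++ (a , s) ∷ (a , opposite s) ∷ v) (u ++ v)
  relator : ∀ u v j → WStep R (u ++ expand (R j) ++ v) (u ++ v)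

Presented : {m n : ℕ} → (Fin n → Relator m) → SetoidMagma
Presented {m} R = record { Carrier = Word m ; _≈_ = EqClosure (WStep R) ; _∙_ = _++_ }

{-# OPTIONS --safe #-}

-- Homotopy classes of loops in a graph are edge paths modulo stuttering and
-- closed walks of length four.  Label the edges of X by words: the closing
-- edge 4 → 0 of the a-th pentagon by s_a, and the edge from the vertex (i , 2)
-- of the j-th disk to its boundary by the prefix of r_j read off along the
-- boundary up to i.  Every other edge is trivial.  Pentagons have no short
-- cycles, and the boundary of a disk reads r_j = 1, so closed walks of length
-- four have trivial label, and loops have a well-defined class in G.
-- Conversely, along fixed paths to the base point with trivial label, every
-- edge is homotopic to the loop spelling its label; going once around the rim
-- of the j-th disk contracts the loop spelling r_j.
module Submission where

open import Defs
open import Algebra using (Group)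
open import Data.Fin using (Fin; zero; suc; toℕ; fromℕ; fromℕ<; cast; combine; remQuot) renaming (_≤_ to _≤F_)
open import Data.Fin.Patterns using (0F; 1F; 2F; 3F; 4F)
open import Data.Fin.Properties as Fin using (combine-remQuot; toℕ-cast; toℕ-combine; toℕ-fromℕ; toℕ-fromℕ<; toℕ-injective; toℕ<n)
open import Data.List using (List; []; _∷_; _++_; length; lookup)
open import Data.List.Properties using (++-assoc; ++-identityʳ)
open import Data.List.Relation.Binary.Pointwise using (Pointwise; []; _∷_)
open import Data.Nat using (ℕ; zero; suc; _+_; _*_; _≤_; _<_; z≤n; s≤s)
open import Data.Nat.Properties using (≤-trans; <-trans; n<1+n; m≤n*m; *-comm; *-suc; suc-injective)
open import Data.Product using (Σ; _×_; _,_; ∃; proj₁; proj₂)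
open import Data.Product.Properties using (≡-dec)
open import Data.Sign using (Sign; opposite) renaming (+ to ⊕; - to ⊖)
open import Data.Sign.Properties using (opposite-involutive)
open import Data.Sum using (inj₁; inj₂)
open import Function using (_∘_)
open import Relation.Binary using (DecidableEquality; IsEquivalence; Setoid)
open import Relation.Binary.Construct.Closure.Equivalence as EC using (EqClosure)
open import Relation.Binary.PropositionalEquality as PE using (_≡_; refl; cong; cong₂; subst; subst₂)
import Relation.Binary.Reasoning.Setoid as SetoidReasoning
open import Relation.Nullary using (yes; no)
open import Relation.Nullary.Decidable using (map′; _×-dec_)

-- The vertex set of `X R` is a quotient by a generated equivalence, on which adjacency cannot be
-- analysed by cases. The labels are therefore defined on `NF`, an inductive type with one element
-- for each vertex and an inductive relation of being equal or adjacent. The condition on closed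
-- walks of length four then becomes a finite case analysis. The depth 3 of the disks is what makes
-- the labelling consistent. Several boundary vertices of a disk may be attached to the same vertex
-- of the wedge, with different prefixes. If the level below the boundary were adjacent to the
-- centre, two such vertices would lie on a closed walk of length four through the centre, which
-- would force their prefixes to agree in the group. With one more level in between, two steps
-- inside the disk lead from a rim vertex only to rim vertices at most two apart, where a shared
-- attaching point does imply equal prefixes in the group.

≅-trans : {M N O : SetoidMagma}
  → (∀ {a b c} → SetoidMagma._≈_ M a b → SetoidMagma._≈_ M b c → SetoidMagma._≈_ M a c)
  → (∀ {a b c} → SetoidMagma._≈_ O a b → SetoidMagma._≈_ O b c → SetoidMagma._≈_ O a c)
  → M ≅ N → N ≅ O → M ≅ O
≅-trans transM transO f g = record
  { to        = λ a → g.to (f.to a)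
  ; from      = λ a → f.from (g.from a)
  ; to-cong   = λ e → g.to-cong (f.to-cong e)
  ; from-cong = λ e → f.from-cong (g.from-cong e)
  ; to-hom    = λ a b → transO (g.to-cong (f.to-hom a b)) (g.to-hom (f.to a) (f.to b))
  ; to-from   = λ a → transO (g.to-cong (f.to-from (g.from a))) (g.to-from a)
  ; from-to   = λ a → transM (f.from-cong (g.from-to (f.to a))) (f.from-to a)
  }
  where
  module f = _≅_ f
  module g = _≅_ g

-- Homotopy of edge paths in a reflexive graph

record ReflGraph : Set₁ where
  field
    V      : Set
    _⌢_    : V → V → Set
    ⌢-refl : ∀ {v} → v ⌢ v

module Paths (Γ : ReflGraph) where
  open ReflGraph Γ

  infixr 5 _∷_ _⨾_
  infix  4 _≋_

  data Path : V → V → Set where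
    []  : ∀ {v} → Path v v
    _∷_ : ∀ {u v w} → u ⌢ v → Path v w → Path u w

  -- `square` fills every closed walk of length four; backtracks and triangles
  -- are the cases with repeated vertices.
  data _≋_ {w : V} : {u : V} → Path u w → Path u w → Set where
    ≋-refl  : ∀ {u} {p : Path u w} → p ≋ p
    ≋-sym   : ∀ {u} {p q : Path u w} → p ≋ q → q ≋ p
    ≋-trans : ∀ {u} {p q r : Path u w} → p ≋ q → q ≋ r → p ≋ r
    prepend : ∀ {u v} (a : u ⌢ v) {p q : Path v w} → p ≋ q → a ∷ p ≋ a ∷ q
    stutter : ∀ {u} (p : Path u w) → ⌢-refl ∷ p ≋ p
    square  : ∀ {u v v′ t} (a : u ⌢ v) (b : v ⌢ t) (a′ : u ⌢ v′) (b′ : v′ ⌢ t) (p : Path t w)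
            → a ∷ b ∷ p ≋ a′ ∷ b′ ∷ p

  pathSetoid : V → V → Setoid _ _
  pathSetoid u w = record
    { Carrier = Path u w
    ; _≈_ = _≋_
    ; isEquivalence = record { refl = ≋-refl ; sym = ≋-sym ; trans = ≋-trans }
    }

  module ≋-Reasoning {u w : V} = SetoidReasoning (pathSetoid u w)
  open ≋-Reasoning

  ≋-reflexive : ∀ {u w} {p q : Path u w} → p ≡ q → p ≋ q
  ≋-reflexive refl = ≋-refl

  triangle : ∀ {u v t w} (a : u ⌢ v) (b : v ⌢ t) (c : u ⌢ t) (p : Path t w) → a ∷ b ∷ p ≋ c ∷ p
  triangle a b c p = ≋-trans (square a b ⌢-refl c p) (stutter (c ∷ p))

  backtrack : ∀ {u v w} (a : u ⌢ v) (b : v ⌢ u) (p : Path u w) → a ∷ b ∷ p ≋ p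
  backtrack a b p = ≋-trans (triangle a b ⌢-refl p) (stutter p)

  -- An edge carries a proof of adjacency, and two such proofs may differ. A triangle with one
  -- stationary side makes the choice irrelevant up to `≋`.
  parallel : ∀ {u v w} (a b : u ⌢ v) (p : Path v w) → a ∷ p ≋ b ∷ p
  parallel a b p = ≋-trans (prepend a (≋-sym (stutter p))) (triangle a ⌢-refl b p)

  constant : ∀ {u w} (a : u ⌢ u) (p : Path u w) → a ∷ p ≋ p
  constant a p = ≋-trans (parallel a ⌢-refl p) (stutter p)

  _⨾_ : ∀ {u v w} → Path u v → Path v w → Path u w
  []      ⨾ q = q
  (a ∷ p) ⨾ q = a ∷ (p ⨾ q)

  ⨾-assoc : ∀ {u v w t} (p : Path u v) (q : Path v w) (r : Path w t) → (p ⨾ q) ⨾ r ≡ p ⨾ (q ⨾ r)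
  ⨾-assoc []      q r = refl
  ⨾-assoc (a ∷ p) q r = cong (a ∷_) (⨾-assoc p q r)

  ⨾-identityʳ : ∀ {u v} (p : Path u v) → p ⨾ [] ≡ p
  ⨾-identityʳ []      = refl
  ⨾-identityʳ (a ∷ p) = cong (a ∷_) (⨾-identityʳ p)

  ⨾-congˡ : ∀ {u v w} (p : Path u v) {q r : Path v w} → q ≋ r → p ⨾ q ≋ p ⨾ r
  ⨾-congˡ []      e = e
  ⨾-congˡ (a ∷ p) e = prepend a (⨾-congˡ p e)

  ⨾-congʳ : ∀ {u v w} {p q : Path u v} (r : Path v w) → p ≋ q → p ⨾ r ≋ q ⨾ r
  ⨾-congʳ r ≋-refl              = ≋-refl
  ⨾-congʳ r (≋-sym e)           = ≋-sym (⨾-congʳ r e)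
  ⨾-congʳ r (≋-trans e f)       = ≋-trans (⨾-congʳ r e) (⨾-congʳ r f)
  ⨾-congʳ r (prepend a e)       = prepend a (⨾-congʳ r e)
  ⨾-congʳ r (stutter p)         = stutter (p ⨾ r)
  ⨾-congʳ r (square a b a′ b′ p) = square a b a′ b′ (p ⨾ r)

  loopMagma : V → SetoidMagma
  loopMagma x = record { Carrier = Path x x ; _≈_ = _≋_ ; _∙_ = _⨾_ }

  module Reverse (⌢-sym : ∀ {u v} → u ⌢ v → v ⌢ u) where

    reverse : ∀ {u v} → Path u v → Path v u
    reverse []      = []
    reverse (a ∷ p) = reverse p ⨾ (⌢-sym a ∷ [])

    ⨾-reverse : ∀ {u v} (p : Path u v) → p ⨾ reverse p ≋ []
    ⨾-reverse []      = ≋-refl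
    ⨾-reverse (a ∷ p) = begin
      a ∷ (p ⨾ (reverse p ⨾ (⌢-sym a ∷ [])))  ≡⟨ cong (a ∷_) (⨾-assoc p (reverse p) _) ⟨
      a ∷ ((p ⨾ reverse p) ⨾ (⌢-sym a ∷ []))  ≈⟨ prepend a (⨾-congʳ _ (⨾-reverse p)) ⟩
      a ∷ ⌢-sym a ∷ []                        ≈⟨ backtrack a (⌢-sym a) [] ⟩
      []                                      ∎

    reverse-⨾ : ∀ {u v} (p : Path u v) → reverse p ⨾ p ≋ []
    reverse-⨾ []      = ≋-refl
    reverse-⨾ (a ∷ p) = begin
      (reverse p ⨾ (⌢-sym a ∷ [])) ⨾ (a ∷ p)  ≡⟨ ⨾-assoc (reverse p) _ _ ⟩
      reverse p ⨾ (⌢-sym a ∷ a ∷ p)           ≈⟨ ⨾-congˡ (reverse p) (backtrack (⌢-sym a) a p) ⟩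
      reverse p ⨾ p                           ≈⟨ reverse-⨾ p ⟩
      []                                      ∎

    ⨾-cancelˡ : ∀ {u v w} (p : Path u v) {q r : Path v w} → p ⨾ q ≋ p ⨾ r → q ≋ r
    ⨾-cancelˡ p {q} {r} e = begin
      q                    ≈⟨ ⨾-congʳ q (reverse-⨾ p) ⟨
      (reverse p ⨾ p) ⨾ q  ≡⟨ ⨾-assoc (reverse p) p q ⟩
      reverse p ⨾ (p ⨾ q)  ≈⟨ ⨾-congˡ (reverse p) e ⟩
      reverse p ⨾ (p ⨾ r)  ≡⟨ ⨾-assoc (reverse p) p r ⟨
      (reverse p ⨾ p) ⨾ r  ≈⟨ ⨾-congʳ r (reverse-⨾ p) ⟩
      r                    ∎

-- Functoriality of path classes and their invariance under equivalence

module _ {Γ Δ : ReflGraph} where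
  private
    module Γ = ReflGraph Γ
    module Δ = ReflGraph Δ
    module P = Paths Γ
    module Q = Paths Δ
  open Paths using ([]; _∷_)

  module MapPath (f : Γ.V → Δ.V) (f-edge : ∀ {u v} → u Γ.⌢ v → f u Δ.⌢ f v) where

    mapPath : ∀ {u v} → P.Path u v → Q.Path (f u) (f v)
    mapPath []      = []
    mapPath (a ∷ p) = f-edge a ∷ mapPath p

    mapPath-⨾ : ∀ {u v w} (p : P.Path u v) (q : P.Path v w)
              → mapPath (p P.⨾ q) ≡ mapPath p Q.⨾ mapPath q
    mapPath-⨾ []      q = refl
    mapPath-⨾ (a ∷ p) q = cong (f-edge a ∷_) (mapPath-⨾ p q)

    mapPath-cong : ∀ {u v} {p q : P.Path u v} → p P.≋ q → mapPath p Q.≋ mapPath q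
    mapPath-cong P.≋-refl               = Q.≋-refl
    mapPath-cong (P.≋-sym e)            = Q.≋-sym (mapPath-cong e)
    mapPath-cong (P.≋-trans e e′)       = Q.≋-trans (mapPath-cong e) (mapPath-cong e′)
    mapPath-cong (P.prepend a e)        = Q.prepend (f-edge a) (mapPath-cong e)
    -- `f-edge` need not send `⌢-refl` to `⌢-refl`; the image is merely some edge from a vertex to
    -- itself.
    mapPath-cong (P.stutter p)          = Q.constant (f-edge Γ.⌢-refl) (mapPath p)
    mapPath-cong (P.square a b a′ b′ p) = Q.square (f-edge a) (f-edge b) (f-edge a′) (f-edge b′) (mapPath p)

module Equivalence (Γ Δ : ReflGraph) where
  private
    module Γ = ReflGraph Γ
    module Δ = ReflGraph Δ
    module P = Paths Γ
    module Q = Paths Δ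
  open Paths using ([]; _∷_)

  module _
    (f : Γ.V → Δ.V) (f-edge : ∀ {u v} → u Γ.⌢ v → f u Δ.⌢ f v)
    (g : Δ.V → Γ.V) (g-edge : ∀ {u v} → u Δ.⌢ v → g u Γ.⌢ g v)
    (η : ∀ u → u Γ.⌢ g (f u)) (η⁻¹ : ∀ u → g (f u) Γ.⌢ u)
    (ε : ∀ y → f (g y) Δ.⌢ y)
    where

    private
      module F = MapPath {Γ} {Δ} f f-edge
      module G = MapPath {Δ} {Γ} g g-edge

    -- Each edge of `p` gives a closed walk of length four through `u`, `g (f u)`, `g (f v)` and
    -- `v`, so `η` slides along `p` one edge at a time.
    η-natural : ∀ {u v} (p : P.Path u v) → (η u ∷ G.mapPath (F.mapPath p)) P.≋ (p P.⨾ (η v ∷ []))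
    η-natural []              = P.≋-refl
    η-natural {u} (_∷_ {v = v} a p) = P.≋-trans
      (P.square (η u) (g-edge (f-edge a)) a (η v) (G.mapPath (F.mapPath p)))
      (P.prepend a (η-natural p))

    ε-natural : ∀ {y z} (q : Q.Path y z) → (ε y ∷ q) Q.≋ (F.mapPath (G.mapPath q) Q.⨾ (ε z ∷ []))
    ε-natural []              = Q.≋-refl
    ε-natural {y} (_∷_ {v = v} a q) = Q.≋-trans
      (Q.square (ε y) a (f-edge (g-edge a)) (ε v) q)
      (Q.prepend (f-edge (g-edge a)) (ε-natural q))

    loopMagma-equivalence : ∀ x → P.loopMagma x ≅ Q.loopMagma (f x)
    loopMagma-equivalence x = record
      { to        = F.mapPath
      ; from      = conj
      ; to-cong   = F.mapPath-cong
      ; from-cong = λ e → P.prepend (η x) (P.⨾-congʳ _ (G.mapPath-cong e))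
      ; to-hom    = λ p q → Q.≋-reflexive (F.mapPath-⨾ p q)
      ; to-from   = to-from
      ; from-to   = from-to
      }
      where
      conj : Q.Path (f x) (f x) → P.Path x x
      -- The image of `q` under `g` is based at `g (f x)`; `η` and `η⁻¹` carry it back to `x`.
      conj q = η x ∷ (G.mapPath q P.⨾ (η⁻¹ x ∷ []))

      from-to : ∀ p → conj (F.mapPath p) P.≋ p
      from-to p = begin
        (η x ∷ G.mapPath (F.mapPath p)) P.⨾ (η⁻¹ x ∷ [])  ≈⟨ P.⨾-congʳ _ (η-natural p) ⟩
        (p P.⨾ (η x ∷ [])) P.⨾ (η⁻¹ x ∷ [])               ≡⟨ P.⨾-assoc p _ _ ⟩
        p P.⨾ (η x ∷ η⁻¹ x ∷ [])                          ≈⟨ P.⨾-congˡ p (P.backtrack (η x) (η⁻¹ x) []) ⟩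
        p P.⨾ []                                          ≡⟨ P.⨾-identityʳ p ⟩
        p                                                 ∎
        where open P.≋-Reasoning

      to-from : ∀ q → F.mapPath (conj q) Q.≋ q
      to-from q = begin
        f-edge (η x) ∷ F.mapPath (G.mapPath q P.⨾ (η⁻¹ x ∷ []))
          ≡⟨ cong (f-edge (η x) ∷_) (F.mapPath-⨾ (G.mapPath q) _) ⟩
        f-edge (η x) ∷ (F.mapPath (G.mapPath q) Q.⨾ (f-edge (η⁻¹ x) ∷ []))
          -- Both edges run from `f (g (f x))` to `f x`, so `parallel` takes the place of a triangle
          -- identity.
          ≈⟨ Q.prepend _ (Q.⨾-congˡ (F.mapPath (G.mapPath q)) (Q.parallel (f-edge (η⁻¹ x)) (ε (f x)) [])) ⟩
        f-edge (η x) ∷ (F.mapPath (G.mapPath q) Q.⨾ (ε (f x) ∷ []))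
          ≈⟨ Q.prepend _ (ε-natural q) ⟨
        f-edge (η x) ∷ ε (f x) ∷ q
          ≈⟨ Q.backtrack _ _ q ⟩
        q ∎
        where open Q.≋-Reasoning

-- Loops as lists versus loops as paths

module Loops (G : SGraph) where
  open SGraph G using (V; _≈_)
  open IsEquivalence (SGraph.≈-equiv G) using ()
    renaming (refl to ≈-refl; sym to ≈-sym; reflexive to ≈-reflexive)

  reflGraph : ReflGraph
  reflGraph = record { V = V ; _⌢_ = EqOrAdj G ; ⌢-refl = inj₁ ≈-refl }

  open ReflGraph reflGraph using (_⌢_; ⌢-refl)
  open Paths reflGraph

  -- A `Loop` meets its base point only up to `≈`, while the ends of a `Path` are fixed on the nose.
  -- The extra last edge absorbs the difference; `toPath` adds the one at the start.
  closeWalk : ∀ {v vs z} → Walk G v vs → lastV G v vs ⌢ z → Path v z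
  closeWalk []      e = e ∷ []
  closeWalk (s ∷ w) e = s ∷ closeWalk w e

  toPath : ∀ {x} → Loop G x → Path x x
  toPath (loop _ _ w s≈ e≈) = inj₁ (≈-sym s≈) ∷ closeWalk w (inj₁ e≈)

  closeWalk-parallel : ∀ {v vs z} (w w′ : Walk G v vs) (e e′ : lastV G v vs ⌢ z)
                     → closeWalk w e ≋ closeWalk w′ e′
  closeWalk-parallel []      []       e e′ = parallel e e′ []
  closeWalk-parallel (s ∷ w) (s′ ∷ w′) e e′ =
    ≋-trans (parallel s s′ _) (prepend s′ (closeWalk-parallel w w′ e e′))

  -- A pointwise homotopy is a ladder: consecutive rungs bound closed walks of length four, and the
  -- last rung spans a triangle with `z`.
  closeWalk-htpy : ∀ {v v′ vs vs′ z} (w : Walk G v vs) (w′ : Walk G v′ vs′)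
                   (e : lastV G v vs ⌢ z) (e′ : lastV G v′ vs′ ⌢ z)
                 → (h : v ⌢ v′) → Pointwise (EqOrAdj G) vs vs′
                 → closeWalk w e ≋ h ∷ closeWalk w′ e′
  closeWalk-htpy []      []        e e′ h []      = ≋-sym (triangle h e′ e [])
  closeWalk-htpy (s ∷ w) (s′ ∷ w′) e e′ h (k ∷ ks) =
    ≋-trans (prepend s (closeWalk-htpy w w′ e e′ k ks)) (square s k h s′ _)

  -- The value at `zero` is a default that keeps the map monotone; `closeWalk-reparam` applies it to
  -- positive indices.
  predF : ∀ {n} → Fin (suc (suc n)) → Fin (suc n)
  predF zero    = zero
  predF (suc i) = i

  predF-mono : ∀ {n} (i j : Fin (suc (suc n))) → i ≤F j → predF i ≤F predF j
  predF-mono zero    j       _       = z≤n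
  predF-mono (suc i) (suc j) (s≤s p) = p

  toℕ≤0⇒≡zero : ∀ {n} {i : Fin (suc n)} → toℕ i ≤ 0 → i ≡ zero
  toℕ≤0⇒≡zero {i = zero} _ = refl

  module _ {n n′ : ℕ} (ρ : Fin (suc n) → Fin (suc n′))
    (mono : ∀ i j → i ≤F j → ρ i ≤F ρ j) (surj : ∀ k → ∃ λ i → ρ i ≡ k) where

    mono-surj⇒ρ0≡0 : ρ zero ≡ zero
    mono-surj⇒ρ0≡0 with surj zero
    ... | i , ρi≡0 = toℕ≤0⇒≡zero (subst (λ k → toℕ (ρ zero) ≤ toℕ k) ρi≡0 (mono zero i z≤n))

  -- The value of `ρ` at 1 decides each step. If it is 0, then `w` repeats its vertex and stutters.
  -- If it is positive, monotonicity and surjectivity force it to be exactly 1, and both walks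
  -- advance along the same edge.
  closeWalk-reparam : ∀ {v vs vs′ z} (w : Walk G v vs) (w′ : Walk G v vs′)
                      (e : lastV G v vs ⌢ z) (e′ : lastV G v vs′ ⌢ z)
                      (ρ : Fin (suc (length vs)) → Fin (suc (length vs′)))
                    → (∀ i j → i ≤F j → ρ i ≤F ρ j)
                    → (∀ k → ∃ λ i → ρ i ≡ k)
                    → (∀ i → lookup (v ∷ vs) i ≡ lookup (v ∷ vs′) (ρ i))
                    → closeWalk w e ≋ closeWalk w′ e′
  closeWalk-reparam [] [] e e′ ρ mono surj same = parallel e e′ []
  closeWalk-reparam [] (s′ ∷ w′) e e′ ρ mono surj same with surj (suc zero)
  ... | zero , ρ0≡1 with PE.trans (PE.sym (mono-surj⇒ρ0≡0 ρ mono surj)) ρ0≡1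
  ...   | ()
  closeWalk-reparam {v} (s ∷ w) w′ e e′ ρ mono surj same with ρ (suc zero) in ρ1≡
  ... | zero with PE.trans (same (suc zero)) (cong (lookup (v ∷ _)) ρ1≡)
  ...   | refl = ≋-trans (constant s _) (closeWalk-reparam w w′ e e′ (λ i → ρ (suc i))
                   (λ i j i≤j → mono (suc i) (suc j) (s≤s i≤j)) surj′ (λ i → same (suc i)))
    where
    surj′ : ∀ k → ∃ λ i → ρ (suc i) ≡ k
    surj′ k with surj k
    ... | suc i , ρi≡k = i , ρi≡k
    -- The indices 0 and 1 have the same image, so 1 serves as preimage after 0 is dropped.
    ... | zero  , ρ0≡k = zero , PE.trans ρ1≡ (PE.trans (PE.sym (mono-surj⇒ρ0≡0 ρ mono surj)) ρ0≡k)
  closeWalk-reparam {v} {v₁ ∷ vs} (s ∷ w) (_∷_ {w = v₁′} {ws = vs′} s′ w′) e e′ ρ mono surj same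
    | suc k = go v₁≡v₁′ s w
    where
    ρ0≡0 : ρ zero ≡ zero
    ρ0≡0 = mono-surj⇒ρ0≡0 ρ mono surj

    1≤ρ : ∀ i → 1 ≤ toℕ (ρ (suc i))
    1≤ρ i = ≤-trans (subst (λ l → 1 ≤ toℕ l) (PE.sym ρ1≡) (s≤s z≤n)) (mono (suc zero) (suc i) (s≤s z≤n))

    ρ′ : Fin (suc (length vs)) → Fin (suc (length vs′))
    ρ′ i = predF (ρ (suc i))

    suc-predF : ∀ {l} (i : Fin (suc (suc l))) → 1 ≤ toℕ i → suc (predF i) ≡ i
    suc-predF (suc i) _ = refl

    mono′ : ∀ i j → i ≤F j → ρ′ i ≤F ρ′ j
    mono′ i j i≤j = predF-mono _ _ (mono (suc i) (suc j) (s≤s i≤j))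

    surj′ : ∀ l → ∃ λ i → ρ′ i ≡ l
    surj′ l with surj (suc l)
    ... | suc i , ρi≡l = i , cong predF ρi≡l
    ... | zero  , ρ0≡l with PE.trans (PE.sym ρ0≡0) ρ0≡l
    ...   | ()

    same′ : ∀ i → lookup (v₁ ∷ vs) i ≡ lookup (v₁′ ∷ vs′) (ρ′ i)
    same′ i = PE.trans (same (suc i)) (cong (lookup (v ∷ v₁′ ∷ vs′)) (PE.sym (suc-predF (ρ (suc i)) (1≤ρ i))))

    v₁≡v₁′ : v₁ ≡ v₁′
    v₁≡v₁′ = PE.trans (same′ zero) (cong (lookup (v₁′ ∷ vs′)) (mono-surj⇒ρ0≡0 ρ′ mono′ surj′))

    go : v₁ ≡ v₁′ → (s : v ⌢ v₁) (w : Walk G v₁ vs) {e : lastV G v₁ vs ⌢ _}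
       → s ∷ closeWalk w e ≋ s′ ∷ closeWalk w′ e′
    go refl s w {e} = ≋-trans (parallel s s′ _) (prepend s′ (closeWalk-reparam w w′ e e′ ρ′ mono′ surj′ same′))

  toPath-cong : ∀ {x} {γ δ : Loop G x} → _≃_ G γ δ → toPath γ ≋ toPath δ
  toPath-cong = EC.gfold (Setoid.isEquivalence (pathSetoid _ _)) toPath step
    where
    step : ∀ {x} {γ δ : Loop G x} → LoopStep G γ δ → toPath γ ≋ toPath δ
    step {γ = loop _ _ w s≈ e≈} {loop _ _ w′ s≈′ e≈′} (htpy (h ∷ hs)) =
      ≋-trans (prepend _ (closeWalk-htpy w w′ (inj₁ e≈) (inj₁ e≈′) h hs))
              (triangle (inj₁ (≈-sym s≈)) h (inj₁ (≈-sym s≈′)) _)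
    step {γ = loop s _ w s≈ e≈} {loop s′ vs′ w′ s≈′ e≈′} (reparam ρ mono surj same)
      with PE.trans (same zero) (cong (lookup (s′ ∷ vs′)) (mono-surj⇒ρ0≡0 ρ mono surj))
    ... | refl = ≋-trans (parallel (inj₁ (≈-sym s≈)) (inj₁ (≈-sym s≈′)) _)
                   (prepend _ (closeWalk-reparam w w′ (inj₁ e≈) (inj₁ e≈′) ρ mono surj same))

  -- Concatenation of loops drops the start of the second loop, whereas `⨾` makes a detour `a`, `b`
  -- through the base point. One triangle replaces the detour by the equality `p`, a second absorbs
  -- `p` into the next edge.
  closeWalk-++ : ∀ {v vs v′ vs′ x z} (w : Walk G v vs) (p : lastV G v vs ≈ v′) (w′ : Walk G v′ vs′)
                 (a : lastV G v vs ⌢ x) (b : x ⌢ v′)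
                 (e : lastV G v (vs ++ vs′) ⌢ z) (e′ : lastV G v′ vs′ ⌢ z)
               → closeWalk (walk-++ G w p w′) e ≋ closeWalk w a ⨾ (b ∷ closeWalk w′ e′)
  closeWalk-++ [] p [] a b e e′ =
    ≋-sym (≋-trans (triangle a b (inj₁ p) _) (triangle (inj₁ p) e′ e []))
  closeWalk-++ [] p (s ∷ w′) a b e e′ =
    ≋-trans (prepend _ (closeWalk-parallel w′ w′ e e′))
      (≋-sym (≋-trans (triangle a b (inj₁ p) _) (triangle (inj₁ p) s _ _)))
  closeWalk-++ (s ∷ w) p w′ a b e e′ = prepend s (closeWalk-++ w p w′ a b e e′)

  toPath-· : ∀ {x} (γ δ : Loop G x) → toPath (_·_ G γ δ) ≋ toPath γ ⨾ toPath δ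
  toPath-· (loop _ _ w s≈ e≈) (loop _ _ w′ s≈′ e≈′) =
    prepend _ (closeWalk-++ w _ w′ (inj₁ e≈) (inj₁ (≈-sym s≈′)) _ (inj₁ e≈′))

  vertices : ∀ {u w} → Path u w → List V
  vertices []                = []
  vertices (_∷_ {v = v} _ p) = v ∷ vertices p

  pathWalk : ∀ {u w} (p : Path u w) → Walk G u (vertices p)
  pathWalk []      = []
  pathWalk (a ∷ p) = a ∷ pathWalk p

  last-vertices : ∀ {u w} (p : Path u w) → lastV G u (vertices p) ≡ w
  last-vertices []      = refl
  last-vertices (a ∷ p) = last-vertices p

  fromPath : ∀ {x} → Path x x → Loop G x
  fromPath p = loop _ (vertices p) (pathWalk p) ≈-refl (≈-reflexive (last-vertices p))

  -- Removing one repeated vertex is the only kind of reparametrization that turning homotopies of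
  -- paths into homotopies of loops requires.
  data Duplicates : List V → List V → Set where
    here  : ∀ {v vs} → Duplicates (v ∷ v ∷ vs) (v ∷ vs)
    there : ∀ {v vs vs′} → Duplicates vs vs′ → Duplicates (v ∷ vs) (v ∷ vs′)

  record Reparametrization (vs vs′ : List V) : Set where
    field
      ρ    : Fin (length vs) → Fin (length vs′)
      mono : ∀ i j → i ≤F j → ρ i ≤F ρ j
      surj : ∀ k → ∃ λ i → ρ i ≡ k
      same : ∀ i → lookup vs i ≡ lookup vs′ (ρ i)

  duplicates⇒reparametrization : ∀ {vs vs′} → Duplicates vs vs′ → Reparametrization vs vs′
  duplicates⇒reparametrization here = record
    { ρ    = λ { zero → zero ; (suc i) → i }
    ; mono = λ { zero j _ → z≤n ; (suc i) (suc j) (s≤s i≤j) → i≤j }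
    ; surj = λ k → suc k , refl
    ; same = λ { zero → refl ; (suc i) → refl }
    }
  duplicates⇒reparametrization (there d) = record
    { ρ    = λ { zero → zero ; (suc i) → suc (ρ i) }
    ; mono = λ { zero j _ → z≤n ; (suc i) (suc j) (s≤s i≤j) → s≤s (mono i j i≤j) }
    ; surj = λ { zero → zero , refl ; (suc k) → suc (proj₁ (surj k)) , cong suc (proj₂ (surj k)) }
    ; same = λ { zero → refl ; (suc i) → same i }
    }
    where open Reparametrization (duplicates⇒reparametrization d)

  dedup : ∀ {x} {γ δ : Loop G x}
        → Duplicates (Loop.start γ ∷ Loop.rest γ) (Loop.start δ ∷ Loop.rest δ) → _≃_ G γ δ
  dedup d = EC.return (reparam ρ mono surj same)
    where open Reparametrization (duplicates⇒reparametrization d)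

  pointwise-refl : ∀ vs → Pointwise (EqOrAdj G) vs vs
  pointwise-refl []       = []
  pointwise-refl (v ∷ vs) = ⌢-refl ∷ pointwise-refl vs

  -- `≋` rewrites a tail of a path, while `LoopStep` relates whole loops. The part already passed is
  -- kept as a list growing at its far end, so that `prepend` merely extends it.
  data Context (x : V) : V → Set where
    []  : Context x x
    _∷ʳ_ : ∀ {u v} → Context x u → u ⌢ v → Context x v

  plug : ∀ {x u w} → Context x u → Path u w → Path x w
  plug []       p = p
  plug (c ∷ʳ a) p = plug c (a ∷ p)

  plug-duplicates : ∀ {x u w} (c : Context x u) {p q : Path u w}
    → Duplicates (u ∷ vertices p) (u ∷ vertices q)
    → Duplicates (x ∷ vertices (plug c p)) (x ∷ vertices (plug c q))
  plug-duplicates []       d = d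
  plug-duplicates (c ∷ʳ a) d = plug-duplicates c (there d)

  plug-pointwise : ∀ {x u w} (c : Context x u) {p q : Path u w}
    → Pointwise (EqOrAdj G) (u ∷ vertices p) (u ∷ vertices q)
    → Pointwise (EqOrAdj G) (x ∷ vertices (plug c p)) (x ∷ vertices (plug c q))
  plug-pointwise []       h = h
  plug-pointwise (c ∷ʳ a) h = plug-pointwise c (⌢-refl ∷ h)

  fromPath-plug-cong : ∀ {x u} (c : Context x u) {p q : Path u x} → p ≋ q
                     → _≃_ G (fromPath (plug c p)) (fromPath (plug c q))
  fromPath-plug-cong c ≋-refl        = EC.reflexive _
  fromPath-plug-cong c (≋-sym e)     = EC.symmetric _ (fromPath-plug-cong c e)
  fromPath-plug-cong c (≋-trans e f) = EC.transitive _ (fromPath-plug-cong c e) (fromPath-plug-cong c f)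
  fromPath-plug-cong c (prepend a e) = fromPath-plug-cong (c ∷ʳ a) e
  fromPath-plug-cong c (stutter p)   = dedup (plug-duplicates c here)
  -- u v t is stretched to u u v t, which is pointwise adjacent to u v′ t t.
  fromPath-plug-cong c (square {t = t} a b a′ b′ p) =
    EC.transitive _ (EC.symmetric _ (dedup {γ = fromPath (plug c left)} (plug-duplicates c {left} here)))
      (EC.transitive _
        (EC.return (htpy {δ = fromPath (plug c right)}
          (plug-pointwise c {left} {right} (⌢-refl ∷ a′ ∷ b ∷ pointwise-refl (t ∷ vertices p)))))
        (dedup (plug-duplicates c {right} (there (there here)))))
    where
    left  = ⌢-refl ∷ a ∷ b ∷ p
    right = a′ ∷ b′ ∷ ⌢-refl ∷ p

  toPath-fromPath : ∀ {x} (p : Path x x) → toPath (fromPath p) ≋ p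
  toPath-fromPath p = ≋-trans (constant _ _) (close p _)
    where
    close : ∀ {u w} (p : Path u w) (e : lastV G u (vertices p) ⌢ w) → closeWalk (pathWalk p) e ≋ p
    close []      e = constant e []
    close (a ∷ p) e = prepend a (close p e)

  -- The round trip adds `x` at both ends. A pointwise homotopy replaces these two vertices by the
  -- first and last vertex of `γ`, which are then repeated and can be collapsed.
  fromPath-toPath : ∀ {x} (γ : Loop G x) → _≃_ G (fromPath (toPath γ)) γ
  fromPath-toPath {x} γ@(loop s vs w s≈ e≈) =
    EC.transitive _ (EC.return (htpy {δ = stretched} (inj₁ (≈-sym s≈) ∷ ⌢-refl ∷ ends {e = e≈} w)))
      (EC.transitive _ (dedup {δ = extended} here) (dedup {δ = γ} (duplicate-last s vs)))
    where
    w⁺ : Walk G s (vs ++ lastV G s vs ∷ [])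
    w⁺ = walk-++ G w ≈-refl (⌢-refl ∷ [])

    e⁺ : lastV G s (vs ++ lastV G s vs ∷ []) ≈ x
    e⁺ = subst (_≈ x) (PE.sym (last-++ G s vs _)) e≈

    stretched extended : Loop G x
    stretched = loop s (s ∷ vs ++ lastV G s vs ∷ []) (⌢-refl ∷ w⁺) s≈ e⁺
    extended  = loop s (vs ++ lastV G s vs ∷ []) w⁺ s≈ e⁺

    ends : ∀ {v vs} {e : lastV G v vs ≈ x} (w : Walk G v vs)
         → Pointwise (EqOrAdj G) (vertices (closeWalk w (inj₁ e))) (vs ++ lastV G v vs ∷ [])
    ends {e = e} []      = inj₁ (≈-sym e) ∷ []
    ends {e = e} (s ∷ w) = ⌢-refl ∷ ends {e = e} w

    duplicate-last : ∀ v vs → Duplicates (v ∷ vs ++ lastV G v vs ∷ []) (v ∷ vs)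
    duplicate-last v []        = here
    duplicate-last v (v′ ∷ vs) = there (duplicate-last v′ vs)

  A1≅loopMagma : ∀ x → A1 G x ≅ loopMagma x
  A1≅loopMagma x = record
    { to        = toPath
    ; from      = fromPath
    ; to-cong   = toPath-cong
    ; from-cong = fromPath-plug-cong []
    ; to-hom    = toPath-·
    ; to-from   = toPath-fromPath
    ; from-to   = fromPath-toPath
    }

-- The presented group

module _ {m : ℕ} where

  inverse : Word m → Word m
  inverse []            = []
  inverse ((a , s) ∷ w) = inverse w ++ (a , opposite s) ∷ []

module WordGroup {m n : ℕ} (R : Fin n → Relator m) where

  infix 4 _∼_
  _∼_ : Word m → Word m → Set
  _∼_ = EqClosure (WStep R)

  ++-congˡ : ∀ w {u v} → u ∼ v → w ++ u ∼ w ++ v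
  ++-congˡ w = EC.gmap (w ++_) step
    where
    step : ∀ {u v} → WStep R u v → WStep R (w ++ u) (w ++ v)
    step (cancel u v a s) = subst₂ (WStep R) (++-assoc w u _) (++-assoc w u v) (cancel (w ++ u) v a s)
    step (relator u v j)  = subst₂ (WStep R) (++-assoc w u _) (++-assoc w u v) (relator (w ++ u) v j)

  ++-congʳ : ∀ w {u v} → u ∼ v → u ++ w ∼ v ++ w
  ++-congʳ w = EC.gmap (_++ w) step
    where
    step : ∀ {u v} → WStep R u v → WStep R (u ++ w) (v ++ w)
    step (cancel u v a s) =
      subst₂ (WStep R) (PE.sym (++-assoc u _ w)) (PE.sym (++-assoc u v w)) (cancel u (v ++ w) a s)
    step (relator u v j)  = subst₂ (WStep R)
      (PE.sym (PE.trans (++-assoc u _ w) (cong (u ++_) (++-assoc (expand (R j)) v w))))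
      (PE.sym (++-assoc u v w)) (relator u (v ++ w) j)

  ++-inverseʳ : ∀ w → w ++ inverse w ∼ []
  ++-inverseʳ []            = EC.reflexive _
  ++-inverseʳ ((a , s) ∷ w) = EC.transitive _
    (++-congˡ ((a , s) ∷ []) (EC.transitive _
      (IsEquivalence.reflexive (EC.isEquivalence _) (PE.sym (++-assoc w (inverse w) _)))
      (++-congʳ _ (++-inverseʳ w))))
    (EC.return (cancel [] [] a s))

  ++-inverseˡ : ∀ w → inverse w ++ w ∼ []
  ++-inverseˡ []            = EC.reflexive _
  ++-inverseˡ ((a , s) ∷ w) = EC.transitive _
    (IsEquivalence.reflexive (EC.isEquivalence _) (++-assoc (inverse w) _ _))
    (EC.transitive _
      (++-congˡ (inverse w) (EC.return
        (subst (λ s′ → WStep R ((a , opposite s) ∷ (a , s′) ∷ w) w) (opposite-involutive s)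
          (cancel [] w a (opposite s)))))
      (++-inverseˡ w))

  ++-cong : ∀ {u u′ v v′} → u ∼ u′ → v ∼ v′ → u ++ v ∼ u′ ++ v′
  ++-cong {u′ = u′} {v} e f = EC.transitive _ (++-congʳ v e) (++-congˡ u′ f)

  -- Uniqueness of inverses: the inverse of a relator never has to be treated as a rewriting step of
  -- its own.
  inverse-cong : ∀ {u v} → u ∼ v → inverse u ∼ inverse v
  inverse-cong {u} {v} e = begin
    inverse u                      ≡⟨ ++-identityʳ (inverse u) ⟨
    inverse u ++ []                ≈⟨ ++-congˡ (inverse u) (++-inverseʳ v) ⟨
    inverse u ++ v ++ inverse v    ≈⟨ ++-congˡ (inverse u) (++-congʳ (inverse v) e) ⟨
    inverse u ++ u ++ inverse v    ≡⟨ ++-assoc (inverse u) u _ ⟨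
    (inverse u ++ u) ++ inverse v  ≈⟨ ++-congʳ (inverse v) (++-inverseˡ u) ⟩
    inverse v                      ∎
    where open SetoidReasoning (EC.setoid (WStep R))

  wordGroup : Group _ _
  wordGroup = record
    { Carrier = Word m
    ; _≈_     = _∼_
    ; _∙_     = _++_
    ; ε       = []
    ; _⁻¹     = inverse
    ; isGroup = record
      { isMonoid = record
        { isSemigroup = record
          { isMagma = record { isEquivalence = EC.isEquivalence (WStep R) ; ∙-cong = ++-cong }
          ; assoc   = λ u v w → reflexive (++-assoc u v w)
          }
        ; identity = (λ w → EC.reflexive _) , λ w → reflexive (++-identityʳ w)
        }
      ; inverse = ++-inverseˡ , ++-inverseʳ
      ; ⁻¹-cong = inverse-cong
      }
    }
    where open IsEquivalence (EC.isEquivalence (WStep R)) using (reflexive)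

  open Group wordGroup public using (setoid)
    renaming (refl to ∼-refl; sym to ∼-sym; trans to ∼-trans; reflexive to ∼-reflexive)

-- The wedge of pentagons and its closed edge paths

-- An inductive form of `suc (toℕ i) ≡ toℕ j`, so that impossible short walks are refuted by
-- matching.
data Succ : ∀ {k} → Fin k → Fin k → Set where
  zero : ∀ {k} → Succ {suc (suc k)} zero (suc zero)
  suc  : ∀ {k} {i j : Fin k} → Succ i j → Succ (suc i) (suc j)

toℕ⇒Succ : ∀ {k} (i j : Fin k) → suc (toℕ i) ≡ toℕ j → Succ i j
toℕ⇒Succ zero    1F            _ = zero
toℕ⇒Succ zero    (suc (suc j)) ()
toℕ⇒Succ (suc i) (suc j)       e = suc (toℕ⇒Succ i j (suc-injective e))

Succ⇒toℕ : ∀ {k} {i j : Fin k} → Succ i j → suc (toℕ i) ≡ toℕ j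
Succ⇒toℕ zero    = refl
Succ⇒toℕ (suc e) = cong suc (Succ⇒toℕ e)

-- The neighbours of the base point in a pentagon, its vertices 1 and 4.
data End : Fin 4 → Set where
  first : End 0F
  final : End 3F

data Near₄ (t : Fin 4) : Fin 4 → Set where
  same : Near₄ t t
  up   : ∀ {t′} → Succ t t′ → Near₄ t t′
  down : ∀ {t′} → Succ t′ t → Near₄ t t′

Near₄-sym : ∀ {t t′} → Near₄ t t′ → Near₄ t′ t
Near₄-sym same     = same
Near₄-sym (up e)   = down e
Near₄-sym (down e) = up e

-- The path 1 – 2 – 3 – 4 is too long for its ends to have a common neighbour.
ends-unique : ∀ {s t t′} → End t → End t′ → Near₄ t s → Near₄ s t′ → t ≡ t′
ends-unique first first _         _             = refl
ends-unique final final _         _             = refl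
ends-unique first final same      (up ())
ends-unique first final same      (down ())
ends-unique first final (up zero) (up (suc ()))
ends-unique first final (up zero) (down (suc ()))
ends-unique final first same      (up ())
ends-unique final first same      (down ())
ends-unique final first (up (suc (suc (suc ()))))
ends-unique final first (down (suc (suc zero))) (up ())
ends-unique final first (down (suc (suc zero))) (down ())

module _ (m : ℕ) where

  -- `arc a t` is the vertex t + 1 of the a-th pentagon.
  data W : Set where
    base : W
    arc  : Fin m → Fin 4 → W

module _ {m : ℕ} where

  infix 4 _⌢W_
  data _⌢W_ : W m → W m → Set where
    base   : base ⌢W base
    leave  : ∀ {a t} → End t → base ⌢W arc a t
    return : ∀ {a t} → End t → arc a t ⌢W base
    along  : ∀ {a t t′} → Near₄ t t′ → arc a t ⌢W arc a t′

  ⌢W-refl : ∀ {u} → u ⌢W u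
  ⌢W-refl {base}    = base
  ⌢W-refl {arc a t} = along same

  ⌢W-sym : ∀ {u v} → u ⌢W v → v ⌢W u
  ⌢W-sym base       = base
  ⌢W-sym (leave e)  = return e
  ⌢W-sym (return e) = leave e
  ⌢W-sym (along e)  = along (Near₄-sym e)

  exit : Fin m → Fin 4 → Word m
  exit a 3F = (a , ⊕) ∷ []
  exit a _  = []

  -- Defined on pairs of vertices rather than on edges, so that a label cannot depend on the proof
  -- of adjacency.
  labelW : W m → W m → Word m
  labelW (arc a t) base      = exit a t
  labelW base      (arc a t) = inverse (exit a t)
  labelW _         _         = []

  labelW-refl : ∀ u → labelW u u ≡ []
  labelW-refl base      = refl
  labelW-refl (arc a t) = refl

  vertexW : Fin m → Fin 5 → W m
  vertexW a zero    = base
  vertexW a (suc t) = arc a t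

  -- The walk ε_r, continued by the base point after its end.
  position : Word m → ℕ → W m
  position []            _ = base
  position ((a , s) ∷ w) 0 = base
  position ((a , s) ∷ w) 1 = vertexW a (rot s 1F)
  position ((a , s) ∷ w) 2 = vertexW a (rot s 2F)
  position ((a , s) ∷ w) 3 = vertexW a (rot s 3F)
  position ((a , s) ∷ w) 4 = vertexW a (rot s 4F)
  position ((a , s) ∷ w) (suc (suc (suc (suc (suc i))))) = position w i

  position-zero : ∀ w → position w 0 ≡ base
  position-zero []      = refl
  position-zero (x ∷ w) = refl

  position-step : ∀ w i → position w i ⌢W position w (suc i)
  position-step []            _ = base
  position-step ((a , ⊕) ∷ w) 0 = leave first
  position-step ((a , ⊕) ∷ w) 1 = along (up zero)
  position-step ((a , ⊕) ∷ w) 2 = along (up (suc zero))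
  position-step ((a , ⊕) ∷ w) 3 = along (up (suc (suc zero)))
  position-step ((a , ⊕) ∷ w) 4 = subst (arc a 3F ⌢W_) (PE.sym (position-zero w)) (return final)
  position-step ((a , ⊖) ∷ w) 0 = leave final
  position-step ((a , ⊖) ∷ w) 1 = along (down (suc (suc zero)))
  position-step ((a , ⊖) ∷ w) 2 = along (down (suc zero))
  position-step ((a , ⊖) ∷ w) 3 = along (down zero)
  position-step ((a , ⊖) ∷ w) 4 = subst (arc a 0F ⌢W_) (PE.sym (position-zero w)) (return first)
  position-step ((a , s) ∷ w) (suc (suc (suc (suc (suc i))))) = position-step w i

  position-lookup : ∀ w (l : Fin (length w)) (t : Fin 5)
    → position w (5 * toℕ l + toℕ t) ≡ vertexW (proj₁ (lookup w l)) (rot (proj₂ (lookup w l)) t)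
  position-lookup ((a , ⊕) ∷ w) zero 0F = refl
  position-lookup ((a , ⊖) ∷ w) zero 0F = refl
  position-lookup (x ∷ w) zero 1F = refl
  position-lookup (x ∷ w) zero 2F = refl
  position-lookup (x ∷ w) zero 3F = refl
  position-lookup (x ∷ w) zero 4F = refl
  position-lookup (x ∷ w) (suc l) t =
    PE.trans (cong (λ i → position (x ∷ w) (i + toℕ t)) (*-suc 5 (toℕ l))) (position-lookup w l t)

  position-end : ∀ w → position w (5 * length w) ≡ base
  position-end []      = refl
  position-end (x ∷ w) = PE.trans (cong (position (x ∷ w)) (*-suc 5 (length w))) (position-end w)

  prefix : Word m → ℕ → Word m
  prefix w zero    = []
  prefix w (suc i) = prefix w i ++ labelW (position w i) (position w (suc i))

  -- A positive letter crosses the closing edge on its fifth step, a negative one crosses it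
  -- backwards on its first. Either way five steps contribute exactly this letter.
  prefix-∷ : ∀ x w i → prefix (x ∷ w) (5 + i) ≡ x ∷ prefix w i
  prefix-∷ (a , ⊕) w zero rewrite position-zero w = refl
  prefix-∷ (a , ⊖) w zero rewrite position-zero w = refl
  prefix-∷ x w (suc i) = cong (_++ labelW (position w i) (position w (suc i))) (prefix-∷ x w i)

  prefix-full : ∀ w → prefix w (5 * length w) ≡ w
  prefix-full []      = refl
  prefix-full (x ∷ w) = PE.trans (cong (prefix (x ∷ w)) (*-suc 5 (length w)))
    (PE.trans (prefix-∷ x w (5 * length w)) (cong (x ∷_) (prefix-full w)))

-- Normal forms for the vertices of X

module NormalForms {m n : ℕ} (R : Fin n → Relator m) where

  word : Fin n → Word m
  word j = expand (R j)

  size : Fin n → ℕ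
  size j = 5 * deg (R j)

  size≡ : ∀ j → 5 * length (word j) ≡ size j
  size≡ j = cong (5 *_) (length-expand (R j))

  Rim : Set
  Rim = Σ (Fin n) (λ j → Fin (size j))

  attach : Rim → W m
  attach (j , i) = position (word j) (toℕ i)

  -- Levels 2, 1 and 0 of the disks; level 3 lies in the wedge.
  data Inner : Set where
    rim : Rim → Inner
    mid : Rim → Inner
    ctr : Fin n → Inner

  data NF : Set where
    wdg : W m → NF
    inn : Inner → NF

  data Near : Rim → Rim → Set where
    same : ∀ {p} → Near p p
    next : ∀ {j i i′} → CSucc (size j) i i′ → Near (j , i) (j , i′)
    prev : ∀ {j i i′} → CSucc (size j) i′ i → Near (j , i) (j , i′)

  Near-sym : ∀ {p q} → Near p q → Near q p
  Near-sym same     = same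
  Near-sym (next e) = prev e
  Near-sym (prev e) = next e

  infix 4 _⌢I_ _⌢_
  data _⌢I_ : Inner → Inner → Set where
    rim  : ∀ {p q} → Near p q → rim p ⌢I rim q
    mid  : ∀ {p q} → Near p q → mid p ⌢I mid q
    ctr  : ∀ {j} → ctr j ⌢I ctr j
    rim→mid : ∀ {p} → rim p ⌢I mid p
    mid→rim : ∀ {p} → mid p ⌢I rim p
    mid→ctr : ∀ {j i} → mid (j , i) ⌢I ctr j
    ctr→mid : ∀ {j i} → ctr j ⌢I mid (j , i)

  -- The attaching point enters through an equation, since an index `attach p` would be a function
  -- value that matching cannot unify.
  data _⌢_ : NF → NF → Set where
    wdg : ∀ {u v} → u ⌢W v → wdg u ⌢ wdg v
    inn : ∀ {d e} → d ⌢I e → inn d ⌢ inn e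
    rim→wdg : ∀ {p u} → attach p ≡ u → inn (rim p) ⌢ wdg u
    wdg→rim : ∀ {p u} → attach p ≡ u → wdg u ⌢ inn (rim p)

  ⌢I-refl : ∀ {d} → d ⌢I d
  ⌢I-refl {rim p} = rim same
  ⌢I-refl {mid p} = mid same
  ⌢I-refl {ctr j} = ctr

  ⌢I-sym : ∀ {d e} → d ⌢I e → e ⌢I d
  ⌢I-sym (rim e) = rim (Near-sym e)
  ⌢I-sym (mid e) = mid (Near-sym e)
  ⌢I-sym ctr     = ctr
  ⌢I-sym rim→mid = mid→rim
  ⌢I-sym mid→rim = rim→mid
  ⌢I-sym mid→ctr = ctr→mid
  ⌢I-sym ctr→mid = mid→ctr

  ⌢-refl : ∀ {u} → u ⌢ u
  ⌢-refl {wdg u} = wdg ⌢W-refl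
  ⌢-refl {inn d} = inn ⌢I-refl

  ⌢-sym : ∀ {u v} → u ⌢ v → v ⌢ u
  ⌢-sym (wdg e)     = wdg (⌢W-sym e)
  ⌢-sym (inn e)     = inn (⌢I-sym e)
  ⌢-sym (rim→wdg e) = wdg→rim e
  ⌢-sym (wdg→rim e) = rim→wdg e

  nfGraph : ReflGraph
  nfGraph = record { V = NF ; _⌢_ = _⌢_ ; ⌢-refl = ⌢-refl }

  -- At the wrap-around the walk is back at the base point, so the position one past the end agrees
  -- with position 0.
  attach-next : ∀ {j i i′} → CSucc (size j) i i′ → position (word j) (suc (toℕ i)) ≡ attach (j , i′)
  attach-next {j} (inj₁ e) = cong (position (word j)) e
  attach-next {j} {i} {i′} (inj₂ (e , e′)) = begin
    position (word j) (suc (toℕ i))         ≡⟨ cong (position (word j)) (PE.trans e (PE.sym (size≡ j))) ⟩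
    position (word j) (5 * length (word j)) ≡⟨ position-end (word j) ⟩
    base                                    ≡⟨ position-zero (word j) ⟨
    position (word j) 0                     ≡⟨ cong (position (word j)) e′ ⟨
    position (word j) (toℕ i′)              ∎
    where open PE.≡-Reasoning

  attach-step : ∀ {j i i′} → CSucc (size j) i i′ → attach (j , i) ⌢W attach (j , i′)
  attach-step {j} {i} e = subst (attach (j , i) ⌢W_) (attach-next e) (position-step (word j) (toℕ i))

  infix 4 _≟W_ _≟R_ _≟_

  -- Adjacency in `X R` includes inequality of the two vertices. Turning an edge of `NF` into an
  -- equality or an adjacency of representatives therefore needs a decision.
  _≟W_ : DecidableEquality (W m)
  base    ≟W base      = yes refl
  base    ≟W arc b t   = no λ ()
  arc a s ≟W base      = no λ ()
  arc a s ≟W arc b t   =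
    map′ (λ { (refl , refl) → refl }) (λ { refl → refl , refl }) ((a Fin.≟ b) ×-dec (s Fin.≟ t))

  _≟R_ : DecidableEquality Rim
  _≟R_ = ≡-dec Fin._≟_ Fin._≟_

  _≟I_ : DecidableEquality Inner
  rim p ≟I rim q = map′ (cong rim) (λ { refl → refl }) (p ≟R q)
  rim p ≟I mid q = no λ ()
  rim p ≟I ctr j = no λ ()
  mid p ≟I rim q = no λ ()
  mid p ≟I mid q = map′ (cong mid) (λ { refl → refl }) (p ≟R q)
  mid p ≟I ctr j = no λ ()
  ctr i ≟I rim q = no λ ()
  ctr i ≟I mid q = no λ ()
  ctr i ≟I ctr j = map′ (cong ctr) (λ { refl → refl }) (i Fin.≟ j)

  _≟_ : DecidableEquality NF
  wdg u ≟ wdg v = map′ (cong wdg) (λ { refl → refl }) (u ≟W v)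
  wdg u ≟ inn e = no λ ()
  inn d ≟ wdg v = no λ ()
  inn d ≟ inn e = map′ (cong inn) (λ { refl → refl }) (d ≟I e)

  -- Comparison of X with its normal forms

  open SGraph (X R) using (_≈_; _~_)
  open IsEquivalence (SGraph.≈-equiv (X R)) using ()
    renaming (refl to ≈-refl; sym to ≈-sym; trans to ≈-trans; reflexive to ≈-reflexive)

  nfW : Vert (Wedge m) → W m
  nfW (inj₁ _)       = base
  nfW (inj₂ (a , t)) = vertexW a t

  nfDisk : ∀ j → Vert (Disk (size j)) → NF
  nfDisk j (inj₁ (i , 0F)) = inn (ctr j)
  nfDisk j (inj₁ (i , 1F)) = inn (mid (j , i))
  nfDisk j (inj₁ (i , 2F)) = inn (rim (j , i))
  nfDisk j (inj₁ (i , 3F)) = wdg (attach (j , i))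
  nfDisk j (inj₂ _)        = inn (ctr j)

  nf : Vert (X R) → NF
  nf (inj₁ (j , d)) = nfDisk j d
  nf (inj₂ w)       = wdg (nfW w)

  -- `εmap` finds the letter and the offset by division, `position` by recursion in steps of five;
  -- both are compared at `5 * l + t`.
  nfW-εmap : ∀ r k → nfW (εmap r k) ≡ position (expand r) (toℕ k)
  nfW-εmap r k = begin
    vertexW (proj₁ x) (rot (proj₂ x) t)       ≡⟨ position-lookup (expand r) l′ t ⟨
    position (expand r) (5 * toℕ l′ + toℕ t)  ≡⟨ cong (λ i → position (expand r) (5 * i + toℕ t)) (toℕ-cast _ l) ⟩
    position (expand r) (5 * toℕ l + toℕ t)   ≡⟨ cong (position (expand r)) toℕ-k ⟨
    position (expand r) (toℕ k)               ∎
    where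
    open PE.≡-Reasoning
    k′ = cast (*-comm 5 (deg r)) k
    l  = proj₁ (remQuot {deg r} 5 k′)
    t  = proj₂ (remQuot {deg r} 5 k′)
    l′ = cast (PE.sym (length-expand r)) l
    x  = lookup (expand r) l′
    toℕ-k : toℕ k ≡ 5 * toℕ l + toℕ t
    toℕ-k = begin
      toℕ k              ≡⟨ toℕ-cast (*-comm 5 (deg r)) k ⟨
      toℕ k′             ≡⟨ cong toℕ (combine-remQuot {deg r} 5 k′) ⟨
      toℕ (combine l t)  ≡⟨ toℕ-combine l t ⟩
      5 * toℕ l + toℕ t  ∎

  nf-cong : ∀ {u v} → u ≈ v → nf u ≡ nf v
  nf-cong = EC.gfold PE.isEquivalence nf λ
    { (eqA (inΣ {j} e))  → EC.gfold PE.isEquivalence (nfDisk j)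
        (λ { (eqA (refl , refl)) → refl ; (eqB refl) → refl ; (glue _) → refl }) e
    ; (eqB e)            → EC.gfold PE.isEquivalence (wdg ∘ nfW)
        (λ { (eqA refl) → refl ; (eqB (inΣ refl)) → refl ; (glue _) → refl }) e
    ; (glue (j , i))     → cong wdg (PE.sym (nfW-εmap (R j) i))
    }

  repW : W m → Vert (Wedge m)
  repW base      = inj₁ zero
  repW (arc a t) = inj₂ (a , suc t)

  rep : NF → Vert (X R)
  rep (wdg u)             = inj₂ (repW u)
  rep (inn (rim (j , i))) = inj₁ (j , inj₁ (i , 2F))
  rep (inn (mid (j , i))) = inj₁ (j , inj₁ (i , 1F))
  rep (inn (ctr j))       = inj₁ (j , inj₂ zero)

  nf-rep : ∀ y → nf (rep y) ≡ y
  nf-rep (wdg base)      = refl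
  nf-rep (wdg (arc a t)) = refl
  nf-rep (inn (rim p))   = refl
  nf-rep (inn (mid p))   = refl
  nf-rep (inn (ctr j))   = refl

  repW-nfW : ∀ w → rep (wdg (nfW w)) ≈ inj₂ w
  repW-nfW (inj₁ zero)           = ≈-refl
  repW-nfW (inj₂ (a , zero))     = EC.return (eqB (EC.return (glue a)))
  repW-nfW (inj₂ (a , suc t))    = ≈-refl

  rep-nf : ∀ u → rep (nf u) ≈ u
  rep-nf (inj₁ (j , inj₁ (i , 0F))) = EC.return (eqA (inΣ (EC.symmetric _ (EC.return (glue (i , zero))))))
  rep-nf (inj₁ (j , inj₁ (i , 1F))) = ≈-refl
  rep-nf (inj₁ (j , inj₁ (i , 2F))) = ≈-refl
  rep-nf (inj₁ (j , inj₁ (i , 3F))) = ≈-trans (≈-reflexive (cong (rep ∘ wdg) (PE.sym (nfW-εmap (R j) i))))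
    (≈-trans (repW-nfW (εmap (R j) i)) (≈-sym (EC.return (glue (j , i)))))
  rep-nf (inj₁ (j , inj₂ zero))     = ≈-refl
  rep-nf (inj₂ w)                   = repW-nfW w

  vertexW-step : ∀ (a : Fin m) t t′ → CSucc 5 t t′ → vertexW a t ⌢W vertexW a t′
  vertexW-step a 0F      1F      (inj₁ refl) = leave first
  vertexW-step a (suc t) (suc t′) (inj₁ e)   = along (up (toℕ⇒Succ t t′ (suc-injective e)))
  vertexW-step a 4F      0F      (inj₂ _)    = return final

  nfDisk-level : ∀ j i l l′ → suc (toℕ l) ≡ toℕ l′ → nfDisk j (inj₁ (i , l)) ⌢ nfDisk j (inj₁ (i , l′))
  nfDisk-level j i 0F 1F _ = inn ctr→mid
  nfDisk-level j i 1F 2F _ = inn mid→rim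
  nfDisk-level j i 2F 3F _ = rim→wdg refl

  nfDisk-cycle : ∀ j i i′ l → CSucc (size j) i i′ → nfDisk j (inj₁ (i , l)) ⌢ nfDisk j (inj₁ (i′ , l))
  nfDisk-cycle j i i′ 0F e = inn ctr
  nfDisk-cycle j i i′ 1F e = inn (mid (next e))
  nfDisk-cycle j i i′ 2F e = inn (rim (next e))
  nfDisk-cycle j i i′ 3F e = wdg (attach-step e)

  nf-~ : ∀ {u v} → u ~ v → nf u ⌢ nf v
  nf-~ (adjA (inΣ (adjA (inj₁ (inj₁ e , refl)))))             = nfDisk-cycle _ _ _ _ e
  nf-~ (adjA (inΣ (adjA (inj₁ (inj₂ e , refl)))))             = ⌢-sym (nfDisk-cycle _ _ _ _ e)
  nf-~ (adjA (inΣ (adjA {_ , l} {_ , l′} (inj₂ (refl , inj₁ e))))) = nfDisk-level _ _ l l′ e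
  nf-~ (adjA (inΣ (adjA {_ , l} {_ , l′} (inj₂ (refl , inj₂ e))))) = ⌢-sym (nfDisk-level _ _ l′ l e)
  nf-~ (adjA (inΣ (adjB {zero} {zero} (inj₁ ()))))
  nf-~ (adjA (inΣ (adjB {zero} {zero} (inj₂ ()))))
  nf-~ (adjB (adjA {zero} {zero} (inj₁ ())))
  nf-~ (adjB (adjA {zero} {zero} (inj₂ ())))
  nf-~ (adjB (adjB (inΣ {a} {t} {t′} (inj₁ e))))              = wdg (vertexW-step a t t′ e)
  nf-~ (adjB (adjB (inΣ {a} {t} {t′} (inj₂ e))))              = ⌢-sym (wdg (vertexW-step a t′ t e))

  nf-edge : ∀ {u v} → EqOrAdj (X R) u v → nf u ⌢ nf v
  nf-edge {u} (inj₁ e) = subst (nf u ⌢_) (nf-cong e) ⌢-refl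
  nf-edge (inj₂ (_ , _ , _ , u≈ , v≈ , e)) =
    subst₂ _⌢_ (PE.sym (nf-cong u≈)) (PE.sym (nf-cong v≈)) (nf-~ e)

  -- The raw edge may join other representatives than those chosen by `rep`: a boundary vertex is
  -- represented in the wedge, but its edge to the rim lies in the disk.
  data Realised : NF → NF → Set where
    equal : ∀ {y} → Realised y y
    edge  : ∀ u v → u ~ v → Realised (nf u) (nf v)

  realise : ∀ {y z} → y ⌢ z → Realised y z
  realise = go
    where
    circle : ∀ a t t′ → SGraph._~_ (Cycle 5) t t′ → Realised (wdg (vertexW a t)) (wdg (vertexW a t′))
    circle a t t′ e = edge (inj₂ (wv a t)) (inj₂ (wv a t′)) (adjB (adjB (inΣ e)))

    disk : ∀ j d e → SGraph._~_ (Cycle (size j) □ Interval 3) d e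
         → Realised (nfDisk j (inj₁ d)) (nfDisk j (inj₁ e))
    disk j d e de = edge (inj₁ (j , inj₁ d)) (inj₁ (j , inj₁ e)) (adjA (inΣ (adjA de)))

    go : ∀ {y z} → y ⌢ z → Realised y z
    go (wdg base)                              = equal
    go (wdg (leave {a} first))                 = circle a 0F 1F (inj₁ (inj₁ refl))
    go (wdg (leave {a} final))                 = circle a 0F 4F (inj₂ (inj₂ (refl , refl)))
    go (wdg (return {a} first))                = circle a 1F 0F (inj₂ (inj₁ refl))
    go (wdg (return {a} final))                = circle a 4F 0F (inj₁ (inj₂ (refl , refl)))
    go (wdg (along same))                      = equal
    go (wdg (along {a} {t} {t′} (up e)))       = circle a (suc t) (suc t′) (inj₁ (inj₁ (cong suc (Succ⇒toℕ e))))
    go (wdg (along {a} {t} {t′} (down e)))     = circle a (suc t) (suc t′) (inj₂ (inj₁ (cong suc (Succ⇒toℕ e))))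
    go (inn (rim same))                        = equal
    go (inn (rim (next {j} {i} {i′} e)))       = disk j (i , 2F) (i′ , 2F) (inj₁ (inj₁ e , refl))
    go (inn (rim (prev {j} {i} {i′} e)))       = disk j (i , 2F) (i′ , 2F) (inj₁ (inj₂ e , refl))
    go (inn (mid same))                        = equal
    go (inn (mid (next {j} {i} {i′} e)))       = disk j (i , 1F) (i′ , 1F) (inj₁ (inj₁ e , refl))
    go (inn (mid (prev {j} {i} {i′} e)))       = disk j (i , 1F) (i′ , 1F) (inj₁ (inj₂ e , refl))
    go (inn ctr)                               = equal
    go (inn (rim→mid {j , i}))                 = disk j (i , 2F) (i , 1F) (inj₂ (refl , inj₂ refl))
    go (inn (mid→rim {j , i}))                 = disk j (i , 1F) (i , 2F) (inj₂ (refl , inj₁ refl))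
    go (inn (mid→ctr {j} {i}))                 = disk j (i , 1F) (i , 0F) (inj₂ (refl , inj₂ refl))
    go (inn (ctr→mid {j} {i}))                 = disk j (i , 0F) (i , 1F) (inj₂ (refl , inj₁ refl))
    go (rim→wdg {j , i} refl)                  = disk j (i , 2F) (i , 3F) (inj₂ (refl , inj₁ refl))
    go (wdg→rim {j , i} refl)                  = disk j (i , 3F) (i , 2F) (inj₂ (refl , inj₂ refl))

  rep-edge : ∀ {y z} → y ⌢ z → EqOrAdj (X R) (rep y) (rep z)
  rep-edge {y} {z} e with y ≟ z | realise e
  ... | yes refl | _     = inj₁ ≈-refl
  ... | no _     | equal = inj₁ ≈-refl
  ... | no y≢z   | edge u v uv = inj₂
    ( (λ e → y≢z (PE.trans (PE.sym (nf-rep y)) (PE.trans (nf-cong e) (nf-rep z))))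
    , u , v , rep-nf u , rep-nf v , uv)

  loopMagma-nf : ∀ x → Paths.loopMagma (Loops.reflGraph (X R)) x ≅ Paths.loopMagma nfGraph (nf x)
  loopMagma-nf = Equivalence.loopMagma-equivalence (Loops.reflGraph (X R)) nfGraph nf nf-edge rep rep-edge
    (λ u → inj₁ (≈-sym (rep-nf u))) (λ u → inj₁ (rep-nf u))
    (λ y → subst (nf (rep y) ⌢_) (nf-rep y) ⌢-refl)

-- From paths to words

module Labels {m n : ℕ} (R : Fin n → Relator m) where
  open WordGroup R
  open NormalForms R
  open Paths nfGraph
  module ∼-Reasoning = SetoidReasoning setoid

  -- The word read when an inner vertex is left for the wedge. Only rim vertices have such edges;
  -- elsewhere the empty word is a default.
  potential : Inner → Word m
  potential (rim (j , i)) = prefix (word j) (toℕ i)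
  potential _             = []

  label : NF → NF → Word m
  label (wdg u) (wdg v) = labelW u v
  label (inn d) (wdg _) = potential d
  label (wdg _) (inn d) = inverse (potential d)
  label (inn _) (inn _) = []

  label-refl : ∀ u → label u u ≡ []
  label-refl (wdg u) = labelW-refl u
  label-refl (inn d) = refl

  labelW-inverse : ∀ u v → labelW u v ++ labelW v u ∼ []
  labelW-inverse base      base      = ∼-refl
  labelW-inverse base      (arc a t) = ++-inverseˡ (exit a t)
  labelW-inverse (arc a t) base      = ++-inverseʳ (exit a t)
  labelW-inverse (arc a t) (arc b s) = ∼-refl

  relator∼[] : ∀ j → word j ∼ []
  relator∼[] j = subst (_∼ []) (++-identityʳ (word j)) (EC.return (relator [] [] j))

  -- Wherever the walk meets an arc at two of its ends, `ends-unique` identifies them. The `exit`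
  -- words then coincide or cancel.
  labelW-square : ∀ {u v v′ t} → u ⌢W v → v ⌢W t → u ⌢W v′ → v′ ⌢W t
                → labelW u v ++ labelW v t ∼ labelW u v′ ++ labelW v′ t
  labelW-square base base base base = ∼-refl
  labelW-square base base (leave {a} {t} _) (return _) = ∼-sym (++-inverseˡ (exit a t))
  labelW-square base (leave _) base (leave _) = ∼-refl
  labelW-square base (leave e) (leave {a} {t} e′) (along k) with ends-unique e′ e k same
  ... | refl = ∼-sym (∼-reflexive (++-identityʳ (inverse (exit a t))))
  labelW-square (leave {a} {t} _) (return _) base base = ++-inverseˡ (exit a t)
  labelW-square (leave {a} {s} _) (return _) (leave {b} {t} _) (return _) =
    ∼-trans (++-inverseˡ (exit a s)) (∼-sym (++-inverseˡ (exit b t)))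
  labelW-square (leave {a} {t} e) (along k) base (leave e′) with ends-unique e e′ k same
  ... | refl = ∼-reflexive (++-identityʳ (inverse (exit a t)))
  labelW-square (leave e) (along k) (leave e′) (along k′) with ends-unique e e′ k (Near₄-sym k′)
  ... | refl = ∼-refl
  labelW-square (return _) base (return _) base = ∼-refl
  labelW-square (return {a} {t} e) base (along k) (return e′) with ends-unique e e′ k same
  ... | refl = ∼-reflexive (++-identityʳ (exit a t))
  labelW-square (return _) (leave _) (return _) (leave _) = ∼-refl
  labelW-square (return {a} {t} e) (leave e′) (along k) (along k′) with ends-unique e e′ k k′
  ... | refl = ++-inverseʳ (exit a t)
  labelW-square (along k) (return e) (return {a} {t} e′) base with ends-unique e′ e k same
  ... | refl = ∼-sym (∼-reflexive (++-identityʳ (exit a t)))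
  labelW-square (along k) (return e) (along k′) (return e′) with ends-unique e e′ (Near₄-sym k) k′
  ... | refl = ∼-refl
  labelW-square (along k) (along k′) (return {a} {t} e) (leave e′) with ends-unique e e′ k k′
  ... | refl = ∼-sym (++-inverseʳ (exit a t))
  labelW-square (along _) (along _) (along _) (along _) = ∼-refl

  potential-next : ∀ {j i i′} → CSucc (size j) i i′
    → potential (rim (j , i)) ++ labelW (attach (j , i)) (attach (j , i′)) ∼ potential (rim (j , i′))
  potential-next {j} {i} {i′} e = begin
    prefix (word j) (toℕ i) ++ labelW (attach (j , i)) (attach (j , i′))
      ≡⟨ cong (λ u → prefix (word j) (toℕ i) ++ labelW (attach (j , i)) u) (attach-next e) ⟨
    prefix (word j) (suc (toℕ i))
      ≈⟨ full e ⟩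
    prefix (word j) (toℕ i′) ∎
    where
    open ∼-Reasoning
    full : CSucc (size j) i i′ → prefix (word j) (suc (toℕ i)) ∼ prefix (word j) (toℕ i′)
    full (inj₁ e)        = ∼-reflexive (cong (prefix (word j)) e)
    -- Here `prefix` jumps from the whole relator to the empty word. This seam is the one place
    -- where consistency of the labels rests on the relation itself.
    full (inj₂ (e , e′)) = begin
      prefix (word j) (suc (toℕ i))          ≡⟨ cong (prefix (word j)) (PE.trans e (PE.sym (size≡ j))) ⟩
      prefix (word j) (5 * length (word j))  ≡⟨ prefix-full (word j) ⟩
      word j                                 ≈⟨ relator∼[] j ⟩
      prefix (word j) 0                      ≡⟨ cong (prefix (word j)) e′ ⟨
      prefix (word j) (toℕ i′)               ∎

  potential-near : ∀ {p q} → Near p q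
    → potential (rim p) ++ labelW (attach p) (attach q) ∼ potential (rim q)
  potential-near {p} same = ∼-reflexive
    (PE.trans (cong (potential (rim p) ++_) (labelW-refl (attach p))) (++-identityʳ (potential (rim p))))
  potential-near (next e) = potential-next e
  potential-near {p} {q} (prev e) = begin
    potential (rim p) ++ labelW (attach p) (attach q)
      ≈⟨ ++-congʳ (labelW (attach p) (attach q)) (potential-next e) ⟨
    (potential (rim q) ++ labelW (attach q) (attach p)) ++ labelW (attach p) (attach q)
      ≡⟨ ++-assoc (potential (rim q)) _ _ ⟩
    potential (rim q) ++ labelW (attach q) (attach p) ++ labelW (attach p) (attach q)
      ≈⟨ ++-congˡ (potential (rim q)) (labelW-inverse (attach q) (attach p)) ⟩
    potential (rim q) ++ []
      ≡⟨ ++-identityʳ (potential (rim q)) ⟩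
    potential (rim q) ∎
    where open ∼-Reasoning

  -- The walk between the two attaching points below d is a backtrack.
  potential-fold : ∀ {p q d} → rim p ⌢I d → d ⌢I rim q → attach p ≡ attach q
                 → potential (rim p) ∼ potential (rim q)
  potential-fold rim→mid mid→rim _ = ∼-refl
  potential-fold {p} {q} (rim {q = r} k) (rim k′) p≡q = begin
    potential (rim p)
      ≡⟨ ++-identityʳ (potential (rim p)) ⟨
    potential (rim p) ++ []
      ≈⟨ ++-congˡ (potential (rim p)) (labelW-inverse (attach p) (attach r)) ⟨
    potential (rim p) ++ labelW (attach p) (attach r) ++ labelW (attach r) (attach p)
      ≡⟨ ++-assoc (potential (rim p)) _ _ ⟨
    (potential (rim p) ++ labelW (attach p) (attach r)) ++ labelW (attach r) (attach p)
      ≈⟨ ++-congʳ _ (potential-near k) ⟩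
    potential (rim r) ++ labelW (attach r) (attach p)
      ≡⟨ cong (λ u → potential (rim r) ++ labelW (attach r) u) p≡q ⟩
    potential (rim r) ++ labelW (attach r) (attach q)
      ≈⟨ potential-near k′ ⟩
    potential (rim q) ∎
    where open ∼-Reasoning

  potential-cancel : ∀ {p q d} → rim p ⌢I d → d ⌢I rim q → attach p ≡ attach q
                   → potential (rim p) ++ inverse (potential (rim q)) ∼ []
  potential-cancel {q = q} a b e =
    ∼-trans (++-congʳ (inverse (potential (rim q))) (potential-fold a b e)) (++-inverseʳ (potential (rim q)))

  -- Solves `p l = q` for the inverse of `p`: the form of `potential-near` for squares leading from
  -- the wedge into a disk. The trailing `[]` is the label of their rim edge.
  inverse-shift : ∀ p l q → p ++ l ∼ q → inverse p ++ [] ∼ l ++ inverse q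
  inverse-shift p l q e = begin
    inverse p ++ []                       ≈⟨ ++-congˡ (inverse p) (++-inverseʳ q) ⟨
    inverse p ++ q ++ inverse q           ≈⟨ ++-congˡ (inverse p) (++-congʳ (inverse q) e) ⟨
    inverse p ++ (p ++ l) ++ inverse q    ≡⟨ cong (inverse p ++_) (++-assoc p l _) ⟩
    inverse p ++ p ++ l ++ inverse q      ≡⟨ ++-assoc (inverse p) p _ ⟨
    (inverse p ++ p) ++ l ++ inverse q    ≈⟨ ++-congʳ _ (++-inverseˡ p) ⟩
    l ++ inverse q                        ∎
    where open ∼-Reasoning

  -- Apart from squares with equal sides or two backtracks, the mixed cases are of two kinds: a rim
  -- edge opposite a wedge edge, settled by `potential-near`, and two rim vertices over one
  -- attaching point, settled by `potential-fold`.
  label-square : ∀ {u v v′ t} → u ⌢ v → v ⌢ t → u ⌢ v′ → v′ ⌢ t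
               → label u v ++ label v t ∼ label u v′ ++ label v′ t
  label-square (wdg a) (wdg b) (wdg a′) (wdg b′) = labelW-square a b a′ b′
  label-square (wdg {u} {v} _) (wdg _) (wdg→rim {p} refl) (rim→wdg refl) =
    ∼-trans (labelW-inverse u v) (∼-sym (++-inverseˡ (potential (rim p))))
  label-square (wdg _) (wdg→rim refl) (wdg _) (wdg→rim refl) = ∼-refl
  label-square (wdg {u} {v} _) (wdg→rim {q} refl) (wdg→rim {p} refl) (inn (rim k)) =
    ∼-sym (inverse-shift (potential (rim p)) (labelW u v) (potential (rim q)) (potential-near k))
  label-square (wdg→rim {p} refl) (rim→wdg refl) (wdg {u} {v} _) (wdg _) =
    ∼-trans (++-inverseˡ (potential (rim p))) (∼-sym (labelW-inverse u v))
  label-square (wdg→rim {p} refl) (rim→wdg refl) (wdg→rim {q} _) (rim→wdg _) =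
    ∼-trans (++-inverseˡ (potential (rim p))) (∼-sym (++-inverseˡ (potential (rim q))))
  label-square (wdg→rim {p} refl) (inn (rim k)) (wdg {u} {v} _) (wdg→rim {q} refl) =
    inverse-shift (potential (rim p)) (labelW u v) (potential (rim q)) (potential-near k)
  label-square (wdg→rim {p} refl) (inn a) (wdg→rim {q} e) (inn b) =
    ++-congʳ [] (inverse-cong (potential-fold a (⌢I-sym b) (PE.sym e)))
  label-square (rim→wdg refl) (wdg _) (rim→wdg refl) (wdg _) = ∼-refl
  label-square (rim→wdg refl) (wdg _) (inn (rim k)) (rim→wdg refl) = potential-near k
  label-square (rim→wdg refl) (wdg→rim e) (rim→wdg refl) (wdg→rim e′) = ∼-refl
  label-square (rim→wdg refl) (wdg→rim e) (inn a) (inn b) =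
    potential-cancel a b (PE.sym e)
  label-square (inn (rim k)) (rim→wdg refl) (rim→wdg refl) (wdg _) = ∼-sym (potential-near k)
  label-square (inn a) (rim→wdg refl) (inn a′) (rim→wdg e) = potential-fold (⌢I-sym a) a′ (PE.sym e)
  label-square (inn a) (inn b) (rim→wdg refl) (wdg→rim e) =
    ∼-sym (potential-cancel a b (PE.sym e))
  label-square (inn _) (inn _) (inn _) (inn _) = ∼-refl

  holonomy : ∀ {u v} → Path u v → Word m
  holonomy []                        = []
  holonomy {u} (_∷_ {v = v} _ p) = label u v ++ holonomy p

  holonomy-⨾ : ∀ {u v w} (p : Path u v) (q : Path v w) → holonomy (p ⨾ q) ≡ holonomy p ++ holonomy q
  holonomy-⨾ []      q = refl
  holonomy-⨾ {u} (_∷_ {v = v} a p) q =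
    PE.trans (cong (label u v ++_) (holonomy-⨾ p q)) (PE.sym (++-assoc (label u v) _ _))

  holonomy-cong : ∀ {u v} {p q : Path u v} → p ≋ q → holonomy p ∼ holonomy q
  holonomy-cong ≋-refl        = ∼-refl
  holonomy-cong (≋-sym e)     = ∼-sym (holonomy-cong e)
  holonomy-cong (≋-trans e f) = ∼-trans (holonomy-cong e) (holonomy-cong f)
  holonomy-cong (prepend {u} {v} a e) = ++-congˡ (label u v) (holonomy-cong e)
  holonomy-cong (stutter {u} p) = ∼-reflexive (cong (_++ holonomy p) (label-refl u))
  holonomy-cong (square {u} {v} {v′} {t} a b a′ b′ p) = begin
    label u v ++ label v t ++ holonomy p      ≡⟨ ++-assoc (label u v) _ _ ⟨
    (label u v ++ label v t) ++ holonomy p    ≈⟨ ++-congʳ (holonomy p) (label-square a b a′ b′) ⟩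
    (label u v′ ++ label v′ t) ++ holonomy p  ≡⟨ ++-assoc (label u v′) _ _ ⟩
    label u v′ ++ label v′ t ++ holonomy p    ∎
    where open ∼-Reasoning

-- From words to paths

module Generators {m n : ℕ} (R : Fin n → Relator m) (deg≥1 : ∀ j → 1 ≤ deg (R j)) where
  open WordGroup R
  open NormalForms R
  open Labels R
  open Paths nfGraph
  open Reverse ⌢-sym
  open ≋-Reasoning

  -- Positive degree supplies the boundary vertex 0, through which the centre of the disk is joined
  -- to the base point.
  origin : ∀ j → Fin (size j)
  origin j = fromℕ< {0} (≤-trans (deg≥1 j) (m≤n*m (deg (R j)) 5))

  toℕ-origin : ∀ j → toℕ (origin j) ≡ 0
  toℕ-origin j = toℕ-fromℕ< _

  attach-origin : ∀ j → attach (j , origin j) ≡ base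
  attach-origin j = PE.trans (cong (position (word j)) (toℕ-origin j)) (position-zero (word j))

  potential-origin : ∀ j → potential (rim (j , origin j)) ≡ []
  potential-origin j = cong (prefix (word j)) (toℕ-origin j)

  descend : ∀ a t → Path (wdg (arc a t)) (wdg base)
  descend a 0F = wdg (return first) ∷ []
  descend a 1F = wdg (along (down zero)) ∷ wdg (return first) ∷ []
  descend a 2F = wdg (along (down (suc zero))) ∷ wdg (along (down zero)) ∷ wdg (return first) ∷ []
  descend a 3F = wdg (along (down (suc (suc zero)))) ∷ wdg (along (down (suc zero)))
               ∷ wdg (along (down zero)) ∷ wdg (return first) ∷ []

  -- Pentagons are descended through their vertex 1, away from the closing edge. A disk is left
  -- through its centre and then outwards at `origin`, whose prefix is empty.
  toBase : ∀ u → Path u (wdg base)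
  toBase (wdg base)            = []
  toBase (wdg (arc a t))       = descend a t
  toBase (inn (rim (j , i)))   = inn rim→mid ∷ inn mid→ctr ∷ toBase (inn (ctr j))
  toBase (inn (mid (j , i)))   = inn mid→ctr ∷ toBase (inn (ctr j))
  toBase (inn (ctr j))         =
    inn (ctr→mid {i = origin j}) ∷ inn mid→rim ∷ rim→wdg (attach-origin j) ∷ []

  letter : Fin m × Sign → Path (wdg base) (wdg base)
  letter (a , ⊕) = wdg (leave first) ∷ wdg (along (up zero)) ∷ wdg (along (up (suc zero)))
                 ∷ wdg (along (up (suc (suc zero)))) ∷ wdg (return {a = a} final) ∷ []
  letter (a , ⊖) = wdg (leave {a = a} final) ∷ descend a 3F

  -- Five nested backtracks, removed from the middle outwards.
  letter-opposite : ∀ a s → letter (a , s) ⨾ letter (a , opposite s) ≋ []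
  letter-opposite a ⊕ = begin
    _ ≈⟨ prepend _ (prepend _ (prepend _ (prepend _ (backtrack _ _ _)))) ⟩
    _ ≈⟨ prepend _ (prepend _ (prepend _ (backtrack _ _ _))) ⟩
    _ ≈⟨ prepend _ (prepend _ (backtrack _ _ _)) ⟩
    _ ≈⟨ prepend _ (backtrack _ _ _) ⟩
    _ ≈⟨ backtrack _ _ _ ⟩
    [] ∎
  letter-opposite a ⊖ = begin
    _ ≈⟨ prepend _ (prepend _ (prepend _ (prepend _ (backtrack _ _ _)))) ⟩
    _ ≈⟨ prepend _ (prepend _ (prepend _ (backtrack _ _ _))) ⟩
    _ ≈⟨ prepend _ (prepend _ (backtrack _ _ _)) ⟩
    _ ≈⟨ prepend _ (backtrack _ _ _) ⟩
    _ ≈⟨ backtrack _ _ _ ⟩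
    [] ∎

  loops : Word m → Path (wdg base) (wdg base)
  loops []      = []
  loops (x ∷ w) = letter x ⨾ loops w

  loops-++ : ∀ v w → loops (v ++ w) ≡ loops v ⨾ loops w
  loops-++ []      w = refl
  loops-++ (x ∷ v) w =
    PE.trans (cong (letter x ⨾_) (loops-++ v w)) (PE.sym (⨾-assoc (letter x) (loops v) (loops w)))

  loops-inverseʳ : ∀ w → loops w ⨾ loops (inverse w) ≋ []
  loops-inverseʳ []            = ≋-refl
  loops-inverseʳ ((a , s) ∷ w) = begin
    (x ⨾ loops w) ⨾ loops (inverse w ++ (a , opposite s) ∷ [])
      ≡⟨ ⨾-assoc x (loops w) _ ⟩
    x ⨾ (loops w ⨾ loops (inverse w ++ (a , opposite s) ∷ []))
      ≡⟨ cong (λ q → x ⨾ (loops w ⨾ q)) (loops-++ (inverse w) _) ⟩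
    x ⨾ (loops w ⨾ (loops (inverse w) ⨾ (x′ ⨾ [])))
      ≡⟨ cong (x ⨾_) (⨾-assoc (loops w) (loops (inverse w)) _) ⟨
    x ⨾ ((loops w ⨾ loops (inverse w)) ⨾ (x′ ⨾ []))
      ≈⟨ ⨾-congˡ x (⨾-congʳ (x′ ⨾ []) (loops-inverseʳ w)) ⟩
    x ⨾ (x′ ⨾ [])
      ≡⟨ cong (x ⨾_) (⨾-identityʳ x′) ⟩
    x ⨾ x′
      ≈⟨ letter-opposite a s ⟩
    [] ∎
    where
    x  = letter (a , s)
    x′ = letter (a , opposite s)

  -- The loop `reverse (toBase u)`, `a`, `toBase v` is homotopic to `loops g`; moving the first
  -- factor to the other side avoids the reversal.
  Worth : ∀ {u v} → u ⌢ v → Word m → Set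
  Worth {u} {v} a g = a ∷ toBase v ≋ toBase u ⨾ loops g

  trivial : ∀ {u v} (a : u ⌢ v) → a ∷ toBase v ≋ toBase u → Worth a []
  trivial {u} a e = ≋-trans e (≋-reflexive (PE.sym (⨾-identityʳ (toBase u))))

  worth-reverse : ∀ {u v g h} (a : u ⌢ v) (b : v ⌢ u) → loops g ⨾ loops h ≋ [] → Worth a g → Worth b h
  worth-reverse {u} {v} {g} {h} a b gh e = begin
    b ∷ toBase u                          ≡⟨ cong (b ∷_) (⨾-identityʳ (toBase u)) ⟨
    b ∷ (toBase u ⨾ [])                   ≈⟨ prepend b (⨾-congˡ (toBase u) gh) ⟨
    b ∷ (toBase u ⨾ (loops g ⨾ loops h))  ≡⟨ cong (b ∷_) (⨾-assoc (toBase u) (loops g) (loops h)) ⟨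
    b ∷ ((toBase u ⨾ loops g) ⨾ loops h)  ≈⟨ prepend b (⨾-congʳ (loops h) e) ⟨
    b ∷ a ∷ (toBase v ⨾ loops h)          ≈⟨ backtrack b a _ ⟩
    toBase v ⨾ loops h                    ∎

  worthW : ∀ {u v} (a : u ⌢W v) → Worth (wdg a) (labelW u v)
  worthW base           = trivial (wdg base) (constant (wdg base) [])
  worthW (leave first)  = trivial (wdg (leave first)) (backtrack _ _ [])
  worthW (leave {a} final)  = ≋-reflexive (PE.sym (⨾-identityʳ (letter (a , ⊖))))
  worthW (return first) = ≋-refl
  worthW (return {a} final) =
    worth-reverse {g = (a , ⊖) ∷ []} {(a , ⊕) ∷ []} (wdg (leave final)) (wdg (return final))
    (loops-inverseʳ ((a , ⊖) ∷ [])) (worthW (leave final))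
  worthW (along same)                         = trivial _ (constant _ _)
  worthW (along (up zero))                    = trivial _ (backtrack _ _ _)
  worthW (along (up (suc zero)))              = trivial _ (backtrack _ _ _)
  worthW (along (up (suc (suc zero))))        = trivial _ (backtrack _ _ _)
  worthW (along (up (suc (suc (suc (suc ()))))))
  worthW (along (down zero))                  = trivial _ ≋-refl
  worthW (along (down (suc zero)))            = trivial _ ≋-refl
  worthW (along (down (suc (suc zero))))      = trivial _ ≋-refl
  worthW (along (down (suc (suc (suc (suc ()))))))

  -- Neighbouring vertices at level 1 span a triangle with the centre.
  mid-toBase : ∀ {p q} (k : Near p q) → inn (mid k) ∷ toBase (inn (mid q)) ≋ toBase (inn (mid p))
  mid-toBase same     = constant _ _
  mid-toBase (next k) = triangle _ _ _ _
  mid-toBase (prev k) = triangle _ _ _ _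

  worthI : ∀ {d e} (a : d ⌢I e) → Worth (inn a) []
  -- The square between levels 2 and 1 trades the rim edge for the edge below it.
  worthI (rim k) = trivial (inn (rim k))
    (≋-trans (square _ _ (inn rim→mid) (inn (mid k)) _) (prepend _ (mid-toBase k)))
  worthI (mid k) = trivial (inn (mid k)) (mid-toBase k)
  worthI ctr     = trivial _ (constant _ _)
  worthI rim→mid = trivial _ ≋-refl
  worthI mid→rim = trivial _ (backtrack _ _ _)
  worthI mid→ctr = trivial _ ≋-refl
  worthI ctr→mid = trivial _ (backtrack _ _ _)

  -- Induction along the boundary: a square over each wedge edge passes from one rim vertex to the
  -- next and appends the label of that edge. The number `k` carries the recursion because the
  -- previous vertex is rebuilt by `fromℕ<` and is no subterm of `i`.
  worth-rim : ∀ k j i → toℕ i ≡ k → ∀ {u} (e : attach (j , i) ≡ u)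
            → Worth (rim→wdg {j , i} e) (prefix (word j) (toℕ i))
  -- At `origin` the chosen path runs to the centre and back before it takes this very edge; the
  -- excursion is two backtracks.
  worth-rim zero j i i≡0 {u} e with toℕ-injective (PE.trans i≡0 (PE.sym (toℕ-origin j)))
  ... | refl with PE.trans (PE.sym e) (attach-origin j)
  ...   | refl = subst (Worth (rim→wdg e)) (PE.sym (potential-origin j)) (trivial _ (begin
    rim→wdg e ∷ []                              ≈⟨ parallel _ _ _ ⟩
    rim→wdg (attach-origin j) ∷ []              ≈⟨ backtrack (inn rim→mid) (inn mid→rim) _ ⟨
    inn rim→mid ∷ inn mid→rim ∷ rim→wdg (attach-origin j) ∷ []
                                                ≈⟨ prepend _ (backtrack (inn mid→ctr) (inn ctr→mid) _) ⟨
    toBase (inn (rim (j , origin j)))           ∎))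
  worth-rim (suc k) j i i≡1+k refl = begin
    rim→wdg refl ∷ toBase (wdg (attach q))
      -- The wedge edge is inserted in both directions to supply the missing side of the square.
      ≈⟨ prepend _ (backtrack (wdg (⌢W-sym f)) (wdg f) _) ⟨
    rim→wdg refl ∷ wdg (⌢W-sym f) ∷ wdg f ∷ toBase (wdg (attach q))
      ≈⟨ square _ _ (inn (rim (prev i′→i))) (rim→wdg refl) _ ⟩
    inn (rim (prev i′→i)) ∷ rim→wdg refl ∷ wdg f ∷ toBase (wdg (attach q))
      ≈⟨ prepend _ (prepend _ (worthW f)) ⟩
    inn (rim (prev i′→i)) ∷ ((rim→wdg refl ∷ toBase (wdg (attach p))) ⨾ loops l)
      ≈⟨ prepend _ (⨾-congʳ (loops l) (worth-rim k j i′ i′≡k refl)) ⟩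
    inn (rim (prev i′→i)) ∷ ((toBase (inn (rim p)) ⨾ loops (prefix (word j) (toℕ i′))) ⨾ loops l)
      ≈⟨ ⨾-congʳ (loops l) (⨾-congʳ (loops (prefix (word j) (toℕ i′))) (worthI (rim (prev i′→i)))) ⟩
    ((toBase (inn (rim q)) ⨾ []) ⨾ loops (prefix (word j) (toℕ i′))) ⨾ loops l
      ≡⟨ cong (λ r → (r ⨾ loops (prefix (word j) (toℕ i′))) ⨾ loops l) (⨾-identityʳ (toBase (inn (rim q)))) ⟩
    (toBase (inn (rim q)) ⨾ loops (prefix (word j) (toℕ i′))) ⨾ loops l
      ≡⟨ ⨾-assoc (toBase (inn (rim q))) (loops (prefix (word j) (toℕ i′))) (loops l) ⟩
    toBase (inn (rim q)) ⨾ (loops (prefix (word j) (toℕ i′)) ⨾ loops l)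
      ≡⟨ cong (toBase (inn (rim q)) ⨾_) (loops-++ (prefix (word j) (toℕ i′)) l) ⟨
    toBase (inn (rim q)) ⨾ loops (prefix (word j) (toℕ i′) ++ l)
      ≡⟨ cong (λ g → toBase (inn (rim q)) ⨾ loops g) prefix-q ⟩
    toBase (inn (rim q)) ⨾ loops (prefix (word j) (toℕ i)) ∎
    where
    k<size : k < size j
    k<size = <-trans (n<1+n k) (subst (_< size j) i≡1+k (toℕ<n i))
    i′ : Fin (size j)
    i′ = fromℕ< k<size
    i′≡k : toℕ i′ ≡ k
    i′≡k = toℕ-fromℕ< k<size
    p q : Rim
    p = j , i′
    q = j , i
    i′→i : CSucc (size j) i′ i
    i′→i = inj₁ (PE.trans (cong suc i′≡k) (PE.sym i≡1+k))
    f : attach p ⌢W attach q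
    f = attach-step i′→i
    l : Word m
    l = labelW (attach p) (attach q)
    prefix-q : prefix (word j) (toℕ i′) ++ l ≡ prefix (word j) (toℕ i)
    prefix-q = PE.trans (cong (λ u → prefix (word j) (toℕ i′) ++ labelW (attach p) u) (PE.sym (attach-next i′→i)))
      (cong (prefix (word j)) (PE.trans (cong suc i′≡k) (PE.sym i≡1+k)))

  worth : ∀ {u v} (a : u ⌢ v) → Worth a (label u v)
  worth (wdg a)               = worthW a
  worth (inn a)               = worthI a
  worth (rim→wdg {j , i} e)   = worth-rim (toℕ i) j i refl e
  worth (wdg→rim {j , i} e)   =
    worth-reverse {g = potential (rim (j , i))} {inverse (potential (rim (j , i)))} (rim→wdg e) (wdg→rim e)
      (loops-inverseʳ (potential (rim (j , i)))) (worth-rim (toℕ i) j i refl e)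

  -- The square over the edge from the last rim vertex to the first evaluates one path in two ways:
  -- along the rim it gains nothing, along the wedge it completes the prefix to the whole relator.
  -- The common path to the base point cancels.
  loops-relator : ∀ j → loops (word j) ≋ []
  loops-relator j = ⨾-cancelˡ (toBase (inn (rim q))) (≋-sym (begin
    toBase (inn (rim q)) ⨾ []
      ≈⟨ worthI (rim (next wrap)) ⟨
    inn (rim (next wrap)) ∷ toBase (inn (rim o))
      ≡⟨ cong (inn (rim (next wrap)) ∷_) (⨾-identityʳ (toBase (inn (rim o)))) ⟨
    inn (rim (next wrap)) ∷ (toBase (inn (rim o)) ⨾ [])
      ≡⟨ cong (λ g → inn (rim (next wrap)) ∷ (toBase (inn (rim o)) ⨾ loops g)) (potential-origin j) ⟨
    inn (rim (next wrap)) ∷ (toBase (inn (rim o)) ⨾ loops (potential (rim o)))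
      ≈⟨ prepend _ (worth-rim _ j (origin j) refl refl) ⟨
    inn (rim (next wrap)) ∷ rim→wdg refl ∷ toBase (wdg (attach o))
      ≈⟨ square _ _ (rim→wdg refl) (wdg f) _ ⟩
    rim→wdg refl ∷ wdg f ∷ toBase (wdg (attach o))
      ≈⟨ prepend _ (worthW f) ⟩
    (rim→wdg refl ∷ toBase (wdg (attach q))) ⨾ loops l
      ≈⟨ ⨾-congʳ (loops l) (worth-rim _ j last refl refl) ⟩
    (toBase (inn (rim q)) ⨾ loops (potential (rim q))) ⨾ loops l
      ≡⟨ ⨾-assoc (toBase (inn (rim q))) (loops (potential (rim q))) (loops l) ⟩
    toBase (inn (rim q)) ⨾ (loops (potential (rim q)) ⨾ loops l)
      ≡⟨ cong (toBase (inn (rim q)) ⨾_) (loops-++ (potential (rim q)) l) ⟨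
    toBase (inn (rim q)) ⨾ loops (potential (rim q) ++ l)
      ≡⟨ cong (λ g → toBase (inn (rim q)) ⨾ loops g) full ⟩
    toBase (inn (rim q)) ⨾ loops (word j) ∎))
    where
    last-exists : ∃ λ (i : Fin (size j)) → suc (toℕ i) ≡ size j
    last-exists = go (origin j)
      where
      -- An element of `Fin k` shows that `k` is a successor, which `size j` does not reveal by
      -- computation.
      go : ∀ {k} → Fin k → ∃ λ (i : Fin k) → suc (toℕ i) ≡ k
      go {suc k} _ = fromℕ k , cong suc (toℕ-fromℕ k)
    last : Fin (size j)
    last = proj₁ last-exists
    q o : Rim
    q = j , last
    o = j , origin j
    wrap : CSucc (size j) last (origin j)
    wrap = inj₂ (proj₂ last-exists , toℕ-origin j)
    f : attach q ⌢W attach o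
    f = attach-step wrap
    l : Word m
    l = labelW (attach q) (attach o)
    full : potential (rim q) ++ l ≡ word j
    full = PE.trans (cong (λ u → potential (rim q) ++ labelW (attach q) u) (PE.sym (attach-next wrap)))
      (PE.trans (cong (prefix (word j)) (PE.trans (proj₂ last-exists) (PE.sym (size≡ j)))) (prefix-full (word j)))

  loops-cong : ∀ {v w} → v ∼ w → loops v ≋ loops w
  loops-cong = EC.gfold (Setoid.isEquivalence (pathSetoid _ _)) loops step
    where
    step : ∀ {v w} → WStep R v w → loops v ≋ loops w
    step (cancel u v a s) = begin
      loops (u ++ (a , s) ∷ (a , opposite s) ∷ v)
        ≡⟨ loops-++ u _ ⟩
      loops u ⨾ (letter (a , s) ⨾ (letter (a , opposite s) ⨾ loops v))
        ≡⟨ cong (loops u ⨾_) (⨾-assoc (letter (a , s)) (letter (a , opposite s)) (loops v)) ⟨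
      loops u ⨾ ((letter (a , s) ⨾ letter (a , opposite s)) ⨾ loops v)
        ≈⟨ ⨾-congˡ (loops u) (⨾-congʳ (loops v) (letter-opposite a s)) ⟩
      loops u ⨾ loops v
        ≡⟨ loops-++ u v ⟨
      loops (u ++ v) ∎
    step (relator u v j) = begin
      loops (u ++ word j ++ v)              ≡⟨ loops-++ u _ ⟩
      loops u ⨾ loops (word j ++ v)         ≡⟨ cong (loops u ⨾_) (loops-++ (word j) v) ⟩
      loops u ⨾ (loops (word j) ⨾ loops v)  ≈⟨ ⨾-congˡ (loops u) (⨾-congʳ (loops v) (loops-relator j)) ⟩
      loops u ⨾ loops v                     ≡⟨ loops-++ u v ⟨
      loops (u ++ v)                        ∎

  -- The worths of the edges telescope: the chosen paths at intermediate vertices are passed on from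
  -- edge to edge.
  path-worth : ∀ {u v} (p : Path u v) → p ⨾ toBase v ≋ toBase u ⨾ loops (holonomy p)
  path-worth {u} [] = ≋-reflexive (PE.sym (⨾-identityʳ (toBase u)))
  path-worth {u} {w} (_∷_ {v = v} a p) = begin
    a ∷ (p ⨾ toBase w)                                     ≈⟨ prepend a (path-worth p) ⟩
    (a ∷ toBase v) ⨾ loops (holonomy p)                    ≈⟨ ⨾-congʳ _ (worth a) ⟩
    (toBase u ⨾ loops (label u v)) ⨾ loops (holonomy p)    ≡⟨ ⨾-assoc (toBase u) _ _ ⟩
    toBase u ⨾ (loops (label u v) ⨾ loops (holonomy p))    ≡⟨ cong (toBase u ⨾_) (loops-++ (label u v) (holonomy p)) ⟨
    toBase u ⨾ loops (label u v ++ holonomy p)             ∎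

  holonomy-letter : ∀ x → holonomy (letter x) ≡ x ∷ []
  holonomy-letter (a , ⊕) = refl
  holonomy-letter (a , ⊖) = refl

  holonomy-loops : ∀ w → holonomy (loops w) ≡ w
  holonomy-loops []      = refl
  holonomy-loops (x ∷ w) =
    PE.trans (holonomy-⨾ (letter x) (loops w)) (cong₂ _++_ (holonomy-letter x) (holonomy-loops w))

  holonomy-toBase : ∀ u → holonomy (toBase u) ≡ []
  holonomy-toBase (wdg base)       = refl
  holonomy-toBase (wdg (arc a 0F)) = refl
  holonomy-toBase (wdg (arc a 1F)) = refl
  holonomy-toBase (wdg (arc a 2F)) = refl
  holonomy-toBase (wdg (arc a 3F)) = refl
  holonomy-toBase (inn (rim (j , i))) = holonomy-toBase (inn (ctr j))
  holonomy-toBase (inn (mid (j , i))) = holonomy-toBase (inn (ctr j))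
  holonomy-toBase (inn (ctr j))       = PE.trans (++-identityʳ _) (potential-origin j)

-- Holonomy as an isomorphism onto the presented group

module Isomorphism {m n : ℕ} (R : Fin n → Relator m) (deg≥1 : ∀ j → 1 ≤ deg (R j)) where
  open WordGroup R
  open NormalForms R
  open Labels R
  open Generators R deg≥1
  open Paths nfGraph
  open Reverse ⌢-sym

  loopMagma≅Presented : ∀ y → loopMagma y ≅ Presented R
  loopMagma≅Presented y = record
    { to        = holonomy
    ; from      = conj
    ; to-cong   = holonomy-cong
    ; from-cong = λ e → ⨾-congˡ (toBase y) (⨾-congʳ _ (loops-cong e))
    ; to-hom    = λ p q → ∼-reflexive (holonomy-⨾ p q)
    ; to-from   = to-from
    ; from-to   = from-to
    }
    where
    conj : Word m → Path y y
    conj w = toBase y ⨾ (loops w ⨾ reverse (toBase y))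

    to-from : ∀ w → holonomy (conj w) ∼ w
    to-from w = begin
      holonomy (conj w)
        ≡⟨ holonomy-⨾ (toBase y) _ ⟩
      holonomy (toBase y) ++ holonomy (loops w ⨾ reverse (toBase y))
        ≡⟨ cong₂ _++_ (holonomy-toBase y) (holonomy-⨾ (loops w) _) ⟩
      holonomy (loops w) ++ holonomy (reverse (toBase y))
        ≡⟨ cong (_++ holonomy (reverse (toBase y))) (holonomy-loops w) ⟩
      w ++ holonomy (reverse (toBase y))
        -- The reversed path is not evaluated directly: the trivial holonomy of `toBase y` is
        -- inserted before it, and the two cancel as paths.
        ≡⟨ cong (λ v → w ++ v ++ holonomy (reverse (toBase y))) (holonomy-toBase y) ⟨
      w ++ holonomy (toBase y) ++ holonomy (reverse (toBase y))
        ≡⟨ cong (w ++_) (holonomy-⨾ (toBase y) _) ⟨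
      w ++ holonomy (toBase y ⨾ reverse (toBase y))
        ≈⟨ ++-congˡ w (holonomy-cong (⨾-reverse (toBase y))) ⟩
      w ++ []
        ≡⟨ ++-identityʳ w ⟩
      w ∎
      where open ∼-Reasoning

    from-to : ∀ p → conj (holonomy p) ≋ p
    from-to p = begin
      toBase y ⨾ (loops (holonomy p) ⨾ reverse (toBase y))  ≡⟨ ⨾-assoc (toBase y) _ _ ⟨
      (toBase y ⨾ loops (holonomy p)) ⨾ reverse (toBase y)  ≈⟨ ⨾-congʳ _ (path-worth p) ⟨
      (p ⨾ toBase y) ⨾ reverse (toBase y)                   ≡⟨ ⨾-assoc p _ _ ⟩
      p ⨾ (toBase y ⨾ reverse (toBase y))                   ≈⟨ ⨾-congˡ p (⨾-reverse (toBase y)) ⟩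
      p ⨾ []                                                ≡⟨ ⨾-identityʳ p ⟩
      p                                                     ∎
      where open ≋-Reasoning

theorem6p5 : (m n : ℕ) (R : Fin n → Relator m)
    → (∀ j → 1 ≤ deg (R j))
    → (x : Vert (X R))
    → A1 (X R) x ≅ Presented R
theorem6p5 m n R deg≥1 x =
  ≅-trans (EC.transitive _) (EC.transitive _) (Loops.A1≅loopMagma (X R) x)
    (≅-trans (Paths.≋-trans) (EC.transitive _) (loopMagma-nf x) (loopMagma≅Presented (nf x)))
  where
  open NormalForms R
  open Isomorphism R deg≥1
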